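{- Let $p>1$ be an integer and let $u^{(p)}$ be the fixed point of the substitution $\varphi_p(L)=L^pS$, $\varphi_p(S)=M$, $\varphi_p(M)=L^{p-1}S$ starting with $L$. (i) The Abelian complexity of $u^{(p)}$ satisfies $\mathrm{AC}(n)\le 7$ for all $n\in\mathbb N$. (ii) The bound $7$ is optimal: for every $p>1$ there are infinitely many $n\in\mathbb N$ with $\mathrm{AC}(n)=7$.
   Context: For a finite word $w$ over $\{L,S,M\}$, its Parikh vector is $\Psi(w)=(|w|_L,|w|_S,|w|_M)$, where $|w|_a$ is the number of occurrences of the letter $a$. The Abelian complexity $\mathrm{AC}(n)$ of $u^{(p)}$ is the number of distinct Parikh vectors of factors (finite contiguous blocks) of $u^{(p)}$ of length $n$. -}

module Defs where

open import Data.Nat using (ℕ; zero; suc; _+_; _∸_)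
open import Data.List using (List; []; _∷_; _++_; [_]; replicate; concatMap; length)
open import Data.List.Membership.Propositional using (_∈_)
open import Data.List.Relation.Unary.All using (All)
open import Data.List.Relation.Unary.Unique.Propositional using (Unique)
open import Data.Product using (Σ; ∃; _×_; _,_)
open import Relation.Binary.PropositionalEquality using (_≡_)

data Letter : Set where
  L S M : Letter

Word : Set
Word = ℕ → Letter

φ : ℕ → Letter → List Letter
φ p L = replicate p L ++ [ S ]
φ p S = M ∷ []
φ p M = replicate (p ∸ 1) L ++ [ S ]

φ* : ℕ → List Letter → List Letter
φ* p w = concatMap (φ p) w

iter : ℕ → ℕ → List Letter
iter p zero    = L ∷ []
iter p (suc k) = φ* p (iter p k)

-- i-th letter of a finite word (default L if out of range; never used
-- out of range in u below since |φ_p^(i+1)(L)| > i)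
nth : List Letter → ℕ → Letter
nth []      _       = L
nth (a ∷ w) zero    = a
nth (a ∷ w) (suc i) = nth w i

-- The fixed point u^(p) of φ_p starting with L: its i-th letter is the
-- i-th letter of the prefix φ_p^(i+1)(L) (these prefixes are nested).
u : ℕ → Word
u p i = nth (iter p (suc i)) i

Parikh : Set
Parikh = ℕ × ℕ × ℕ

letterΨ : Letter → Parikh
letterΨ L = 1 , 0 , 0
letterΨ S = 0 , 1 , 0
letterΨ M = 0 , 0 , 1

_⊕_ : Parikh → Parikh → Parikh
(a , b , c) ⊕ (a' , b' , c') = (a + a') , (b + b') , (c + c')

factorΨ : Word → ℕ → ℕ → Parikh
factorΨ x i zero    = 0 , 0 , 0
factorΨ x i (suc n) = letterΨ (x i) ⊕ factorΨ x (suc i) n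

IsFactorΨ : Word → ℕ → Parikh → Set
IsFactorΨ x n v = ∃ λ i → factorΨ x i n ≡ v

HasAC : Word → ℕ → ℕ → Set
HasAC x n k =
  Σ (List Parikh) λ vs →
    (length vs ≡ k) × Unique vs × All (IsFactorΨ x n) vs
    × (∀ i → factorΨ x i n ∈ vs)

{-# OPTIONS --safe #-}
module Submission where

-- Every prefix of u is the image of a shorter prefix followed by at most p letters L, so the Parikh vectors of
-- prefixes obey a linear recursion with digits.  For four prefixes consider the difference D = P₁ + P₂ - P₃ - P₄
-- together with the four following letters.  As long as the corresponding difference of lengths stays in [-5,5],
-- only finitely many such states occur, uniformly in p ≥ 3 (and separately for p = 2).  Among the states of length
-- difference 0 none has 3 ΔS + ΔM ≡ 0 modulo 7 except D = 0.  Hence 3 |w|_S + |w|_M modulo 7 determines Ψ(w)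
-- among the factors of a given length, which gives the bound 7.
--
-- For the lower bound, the two-sided words …S.L… and …M.L… admit the insertion of φ^k(L^p S) at the dot for every
-- k.  Applying φ five times and adjusting both ends yields seven factors of the same length whose values of
-- 3 |w|_S + |w|_M are consecutive integers.

open import Defs
open import Data.Bool using (Bool; true; false; _∧_; _∨_; if_then_else_; T)
open import Data.Bool.ListAction using (all)
open import Data.Bool.Properties using (T-∧; T-∨)
open import Data.Fin using (Fin; zero; suc; toℕ)
open import Data.Fin.Patterns
open import Data.Fin.Properties using (injective⇒≤; toℕ-injective; toℕ-fromℕ<)
open import Data.Integer as ℤ using (ℤ; +_; -[1+_]; ∣_∣; 0ℤ; 1ℤ)
import Data.Integer.Properties as ℤₚ
open import Algebra.Properties.AbelianGroup ℤₚ.+-0-abelianGroup using () renaming (∙-cancelˡ to ℤ-cancelˡ)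
open import Data.Integer.Solver using (module +-*-Solver)
import Data.Integer.Tactic.RingSolver as ℤ-Solver
open import Data.List using (List; []; _∷_; _++_; [_]; replicate; length; lookup; deduplicate; map; concatMap; upTo)
open import Data.List.Properties using (length-++; concatMap-++)
open import Data.List.Membership.Propositional using (_∈_; lose)
open import Data.List.Membership.Propositional.Properties using (∈-lookup; ∈-deduplicate⁺; ∈-deduplicate⁻; ∈-map⁺; ∈-map⁻; ∈-upTo⁺; ∈-concatMap⁺)
open import Data.List.Relation.Unary.All as All using (_∷_)
open import Data.List.Relation.Unary.All.Properties using (all⁺)
open import Data.List.Relation.Unary.Any using (here; there; index)
open import Data.List.Relation.Unary.Any.Properties using (lookup-index)
open import Data.List.Relation.Unary.Unique.Propositional using (Unique; _∷_)
import Data.List.Relation.Unary.Unique.DecPropositional.Properties as Unique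
open import Data.Maybe using (Maybe; just; nothing)
open import Data.Nat
open import Data.Nat.DivMod using (_mod_; m%n<n; m≡m%n+[m/n]*n; m*n%n≡0)
open import Data.Nat.Properties
import Data.Nat.Tactic.RingSolver as ℕ-Solver
open import Data.Product using (∃; ∃₂; _×_; _,_; proj₁; proj₂)
open import Data.Product.Properties using (≡-dec)
open import Data.Sum using (_⊎_; inj₁; inj₂)
open import Function using (_∘_)
open import Function.Bundles using (Equivalence)
open import Relation.Binary.Definitions using (DecidableEquality)
open import Relation.Binary.PropositionalEquality hiding ([_])
open import Relation.Nullary using (contradiction)

-- Obstacle for the upper bound: two factors of equal length generally desubstitute to factors of
-- unequal length, so length difference 0 cannot be followed on its own. The window [-5,5] is chosen
-- such that desubstitution never leaves it. If the lengths of two ancestors differ by exactly 5, so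
-- little is lost at the ends that their descendants still differ by at least 5; every further
-- letter in the longer ancestor adds at least one letter below. Hence ancestors outside the window
-- have only descendants outside it. The case of exactly 5 is tested on each state of the automaton,
-- the rest is induction.
--
-- A second obstacle is constructive: `HasAC` demands an explicit list of Parikh vectors, so a bound
-- on the positions to be searched has to be computed for each length. It comes from the recurrence
-- of windows of the fixed point, independently of the automaton.

nth-++ˡ : ∀ xs {ys i} → i < length xs → nth (xs ++ ys) i ≡ nth xs i
nth-++ˡ (x ∷ xs) {i = zero}  _         = refl
nth-++ˡ (x ∷ xs) {i = suc i} (s≤s i<n) = nth-++ˡ xs i<n

nth-++ʳ : ∀ xs {ys} i → nth (xs ++ ys) (length xs + i) ≡ nth ys i
nth-++ʳ []       i = refl
nth-++ʳ (x ∷ xs) i = nth-++ʳ xs i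

⊕-assoc : ∀ v w x → (v ⊕ w) ⊕ x ≡ v ⊕ (w ⊕ x)
⊕-assoc (a , b , c) (a′ , b′ , c′) (a″ , b″ , c″) =
  cong₂ _,_ (+-assoc a a′ a″) (cong₂ _,_ (+-assoc b b′ b″) (+-assoc c c′ c″))

⊕-identityʳ : ∀ v → v ⊕ (0 , 0 , 0) ≡ v
⊕-identityʳ (a , b , c) = cong₂ _,_ (+-identityʳ a) (cong₂ _,_ (+-identityʳ b) (+-identityʳ c))

∣_∣ₚ : Parikh → ℕ
∣ l , s , m ∣ₚ = l + s + m

-- (s , m) ↦ 3 s + m modulo 7 is a proper colouring of the possible differences between Parikh vectors of
-- factors of the same length.
weight : Parikh → ℕ
weight (l , s , m) = 3 * s + m

-- Counting Parikh vectors through a colouring modulo 7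

lookup-injective : ∀ {A : Set} {xs : List A} → Unique xs → ∀ {i j} → lookup xs i ≡ lookup xs j → i ≡ j
lookup-injective (x≢ ∷ u) {zero}  {zero}  _  = refl
lookup-injective (x≢ ∷ u) {zero}  {suc j} eq = contradiction eq (All.lookup x≢ (∈-lookup j))
lookup-injective (x≢ ∷ u) {suc i} {zero}  eq = contradiction (sym eq) (All.lookup x≢ (∈-lookup i))
lookup-injective (x≢ ∷ u) {suc i} {suc j} eq = cong suc (lookup-injective u eq)

_≟ₚ_ : DecidableEquality Parikh
_≟ₚ_ = ≡-dec _≟_ (≡-dec _≟_ _≟_)

-- Supplies the search bound that turns the set of Parikh vectors into a list. Only Parikh vectors
-- need to reappear below `B`, not the factors themselves.
Recurrent : Word → Set
Recurrent x = ∀ n → ∃ λ B → ∀ i → ∃ λ i′ → i′ < B × factorΨ x i n ≡ factorΨ x i′ n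

Separated : Word → Set
Separated x = ∀ n i j → weight (factorΨ x i n) % 7 ≡ weight (factorΨ x j n) % 7 → factorΨ x i n ≡ factorΨ x j n

complexity : ∀ {x} → Recurrent x → ∀ n → ∃ λ k → HasAC x n k
complexity {x} recurrent n with recurrent n
... | B , bounded = length vs , vs , refl , Unique.deduplicate-! _≟ₚ_ ws , All.tabulate occurs , exhausts
  where
  ws vs : List Parikh
  ws = map (λ i → factorΨ x i n) (upTo B)
  vs = deduplicate _≟ₚ_ ws
  occurs : ∀ {v} → v ∈ vs → IsFactorΨ x n v
  occurs v∈vs with i , _ , v≡ ← ∈-map⁻ (λ i → factorΨ x i n) (∈-deduplicate⁻ _≟ₚ_ ws v∈vs) = i , sym v≡
  exhausts : ∀ i → factorΨ x i n ∈ vs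
  exhausts i with i′ , i′<B , eq ← bounded i =
    ∈-deduplicate⁺ _≟ₚ_ (subst (_∈ ws) (sym eq) (∈-map⁺ (λ i → factorΨ x i n) (∈-upTo⁺ i′<B)))

complexity≤7 : ∀ {x n k} → Separated x → HasAC x n k → k ≤ 7
complexity≤7 {x} {n} separated (vs , refl , unique , occurs , _) = injective⇒≤ {f = colour} colour-injective
  where
  colour : Fin (length vs) → Fin 7
  colour c = weight (lookup vs c) mod 7
  colour-injective : ∀ {c d} → colour c ≡ colour d → c ≡ d
  colour-injective {c} {d} eq
    with i , i≡ ← All.lookup occurs (∈-lookup c) | j , j≡ ← All.lookup occurs (∈-lookup d) =
    lookup-injective unique (trans (sym i≡) (trans (separated n i j (begin
      weight (factorΨ x i n) % 7   ≡⟨ cong (λ v → weight v % 7) i≡ ⟩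
      weight (lookup vs c) % 7     ≡⟨ toℕ-fromℕ< (m%n<n (weight (lookup vs c)) 7) ⟨
      toℕ (colour c)               ≡⟨ cong toℕ eq ⟩
      toℕ (colour d)               ≡⟨ toℕ-fromℕ< (m%n<n (weight (lookup vs d)) 7) ⟩
      weight (lookup vs d) % 7     ≡⟨ cong (λ v → weight v % 7) j≡ ⟨
      weight (factorΨ x j n) % 7   ∎)) j≡))
    where open ≡-Reasoning

complexity≥ : ∀ {x n k} r b → (∀ (c : Fin r) → ∃ λ i → weight (factorΨ x i n) ≡ b + toℕ c) → HasAC x n k → r ≤ k
complexity≥ {x} {n} r b weights (vs , refl , _ , _ , exhausts) = injective⇒≤ {f = place} place-injective
  where
  place : Fin r → Fin (length vs)
  place c = index (exhausts (proj₁ (weights c)))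
  place-weight : ∀ c → weight (lookup vs (place c)) ≡ b + toℕ c
  place-weight c = trans (cong weight (sym (lookup-index (exhausts (proj₁ (weights c)))))) (proj₂ (weights c))
  place-injective : ∀ {c d} → place c ≡ place d → c ≡ d
  place-injective {c} {d} eq = toℕ-injective (+-cancelˡ-≡ b _ _
    (trans (sym (place-weight c)) (trans (cong (weight ∘ lookup vs) eq) (place-weight d))))

SevenWeights : Word → ℕ → Set
SevenWeights x N = ∃₂ λ n b → N ≤ n × (∀ (c : Fin 7) → ∃ λ i → weight (factorΨ x i n) ≡ b + toℕ c)

bounded-by-7 : ∀ {x} → Recurrent x → Separated x → ∀ n → ∃ λ k → k ≤ 7 × HasAC x n k
bounded-by-7 recurrent separated n with complexity recurrent n
... | k , ac = k , complexity≤7 separated ac , ac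

attains-7 : ∀ {x N} → Recurrent x → Separated x → SevenWeights x N → ∃ λ n → N ≤ n × HasAC x n 7
attains-7 {x} recurrent separated (n , b , N≤n , weights) with bounded-by-7 recurrent separated n
... | k , k≤7 , ac = n , N≤n , subst (HasAC x n) (≤-antisym k≤7 (complexity≥ 7 b weights ac)) ac

Agree : Word → ℕ → ℕ → ℕ → Set
Agree x n i j = ∀ {t} → t < n → x (i + t) ≡ x (j + t)

Agree-≤ : ∀ {x n n′} i j → n′ ≤ n → Agree x n i j → Agree x n′ i j
Agree-≤ i j n′≤n agree t<n′ = agree (<-≤-trans t<n′ n′≤n)

Agree-suc : ∀ {x n i j} → Agree x (suc n) i j → Agree x n (suc i) (suc j)
Agree-suc {x} {n} {i} {j} agree {t} t<n =
  trans (cong x (sym (+-suc i t))) (trans (agree (s≤s t<n)) (cong x (+-suc j t)))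

factorΨ-agree : ∀ {x} n {i j} → Agree x n i j → factorΨ x i n ≡ factorΨ x j n
factorΨ-agree         zero            _     = refl
factorΨ-agree {x} (suc n) {i} {j} agree = cong₂ (λ a v → letterΨ a ⊕ v)
  (trans (cong x (sym (+-identityʳ i))) (trans (agree (s≤s z≤n)) (cong x (+-identityʳ j))))
  (factorΨ-agree {x} n (Agree-suc {x} {n} agree))

-- The fixed point and its desubstitution

module FixedPoint (q : ℕ) where

  p : ℕ
  p = 2 + q

  v : Word
  v = u p

  -- Digit a r b: the letter of φ_p(a) at index r is b.
  data Digit : Letter → ℕ → Letter → Set where
    LL : ∀ {r} → r ≤ suc q → Digit L r L
    LS : Digit L p S
    ML : ∀ {r} → r ≤ q → Digit M r L
    MS : Digit M (suc q) S
    SM : Digit S 0 M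

  nth-run : ∀ {r k} → r ≤ k → nth (replicate (suc k) L ++ [ S ]) r ≡ L
  nth-run z≤n       = refl
  nth-run (s≤s r≤k) = nth-run r≤k

  nth-run-end : ∀ k → nth (replicate k L ++ [ S ]) k ≡ S
  nth-run-end zero    = refl
  nth-run-end (suc k) = nth-run-end k

  length-run : ∀ k → length (replicate k L ++ [ S ]) ≡ suc k
  length-run zero    = refl
  length-run (suc k) = cong suc (length-run k)

  size : Letter → ℕ
  size L = suc p
  size S = 1
  size M = p

  length-φ : ∀ a → length (φ p a) ≡ size a
  length-φ L = length-run p
  length-φ S = refl
  length-φ M = length-run (suc q)

  1≤size : ∀ a → 1 ≤ size a
  1≤size L = s≤s z≤n
  1≤size S = s≤s z≤n
  1≤size M = s≤s z≤n

  digit<size : ∀ {a r b} → Digit a r b → r < size a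
  digit<size (LL r≤) = s≤s (m≤n⇒m≤1+n r≤)
  digit<size LS      = ≤-refl
  digit<size (ML r≤) = s≤s (m≤n⇒m≤1+n r≤)
  digit<size MS      = ≤-refl
  digit<size SM      = ≤-refl

  nth-φ : ∀ {a r b} → Digit a r b → nth (φ p a) r ≡ b
  nth-φ (LL r≤) = nth-run r≤
  nth-φ LS      = nth-run-end p
  nth-φ (ML r≤) = nth-run r≤
  nth-φ MS      = nth-run-end (suc q)
  nth-φ SM      = refl

  sizes : List Letter → ℕ → ℕ
  sizes w zero    = 0
  sizes w (suc k) = sizes w k + size (nth w k)

  sizes-∷ : ∀ a w k → sizes (a ∷ w) (suc k) ≡ size a + sizes w k
  sizes-∷ a w zero    = sym (+-identityʳ (size a))
  sizes-∷ a w (suc k) = trans (cong (_+ size (nth w k)) (sizes-∷ a w k))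
                              (+-assoc (size a) (sizes w k) (size (nth w k)))

  nth-φ* : ∀ w {k r b} → k < length w → Digit (nth w k) r b → nth (φ* p w) (sizes w k + r) ≡ b
  nth-φ* (a ∷ w) {zero}  {r} _ d =
    trans (nth-++ˡ (φ p a) (subst (r <_) (sym (length-φ a)) (digit<size d))) (nth-φ d)
  nth-φ* (a ∷ w) {suc k} {r} (s≤s k<n) d =
    trans (cong (nth (φ* p (a ∷ w))) index≡)
      (trans (nth-++ʳ (φ p a) (sizes w k + r)) (nth-φ* w k<n d))
    where
    index≡ : sizes (a ∷ w) (suc k) + r ≡ length (φ p a) + (sizes w k + r)
    index≡ = trans (cong (_+ r) (sizes-∷ a w k))
              (trans (+-assoc (size a) (sizes w k) r)
                (cong (_+ (sizes w k + r)) (sym (length-φ a))))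

  iter-nested : ∀ k → ∃ λ z → iter p (suc k) ≡ iter p k ++ z
  iter-nested zero    = _ , refl
  iter-nested (suc k) with iter-nested k
  ... | z , eq = φ* p z , trans (cong (φ* p) eq) (concatMap-++ (φ p) (iter p k) z)

  length-φ* : ∀ w → length w ≤ length (φ* p w)
  length-φ* []      = z≤n
  length-φ* (a ∷ w) = begin
    1 + length w                      ≤⟨ +-mono-≤ (1≤size a) (length-φ* w) ⟩
    size a + length (φ* p w)          ≡⟨ cong (_+ length (φ* p w)) (length-φ a) ⟨
    length (φ p a) + length (φ* p w)  ≡⟨ length-++ (φ p a) ⟨
    length (φ* p (a ∷ w))             ∎
    where open ≤-Reasoning

  iter-head : ∀ k → ∃ λ w → iter p k ≡ L ∷ w
  iter-head zero    = _ , refl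
  iter-head (suc k) with iter p k | iter-head k
  ... | _ | w , refl = _ , refl

  length-iter : ∀ k → k < length (iter p k)
  length-iter zero    = s≤s z≤n
  length-iter (suc k) with iter p k | iter-head k | length-iter k
  ... | _ | w , refl | s≤s k≤n = begin
    2 + k                                   ≤⟨ s≤s (s≤s (≤-trans k≤n (length-φ* w))) ⟩
    2 + length (φ* p w)                     ≤⟨ +-monoˡ-≤ (length (φ* p w)) (s≤s (s≤s z≤n)) ⟩
    suc p + length (φ* p w)                 ≡⟨ cong (_+ length (φ* p w)) (length-φ L) ⟨
    length (φ p L) + length (φ* p w)        ≡⟨ length-++ (φ p L) ⟨
    length (φ* p (L ∷ w))                   ∎
    where open ≤-Reasoning

  iter-monotone : ∀ {i j} k → i < length (iter p j) →
                  i < length (iter p (k + j)) × nth (iter p (k + j)) i ≡ nth (iter p j) i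
  iter-monotone zero i< = i< , refl
  iter-monotone {i} {j} (suc k) i< with iter-monotone {i} {j} k i< | iter-nested (k + j)
  ... | i<′ , eq | z , nest =
    subst (λ w → i < length w) (sym nest)
      (≤-trans i<′ (≤-trans (m≤m+n _ (length z)) (≤-reflexive (sym (length-++ (iter p (k + j))))))) ,
    trans (cong (λ w → nth w i) nest) (trans (nth-++ˡ (iter p (k + j)) i<′) eq)

  -- Both `iter p j` and the iterate of order `suc i` that defines `v i` are prefixes of
  -- `iter p (suc i + j)`. Any sufficiently long iterate may therefore be used to read off a letter.
  v-nth : ∀ {i} j → i < length (iter p j) → v i ≡ nth (iter p j) i
  v-nth {i} j i< = trans (sym (proj₂ (iter-monotone j (≤-trans (n<1+n i) (<⇒≤ (length-iter (suc i)))))))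
    (trans (cong (λ k → nth (iter p k) i) (+-comm j (suc i)))
      (proj₂ (iter-monotone (suc i) i<)))

  -- pos k = |φ_p(u[0,k))|.
  pos : ℕ → ℕ
  pos zero    = 0
  pos (suc k) = pos k + size (v k)

  sizes-pos : ∀ j k → k ≤ length (iter p j) → sizes (iter p j) k ≡ pos k
  sizes-pos j zero    _  = refl
  sizes-pos j (suc k) k< = cong₂ _+_ (sizes-pos j k (<⇒≤ k<)) (cong size (sym (v-nth j k<)))

  v-digit : ∀ k {r b} → Digit (v k) r b → v (pos k + r) ≡ b
  v-digit k {r} {b} d = begin
    v i                                       ≡⟨ proj₂ (iter-monotone (suc k) i<) ⟨
    nth (iter p (suc k + suc i)) i            ≡⟨ cong (λ x → nth (iter p x) i) (+-comm (suc k) (suc i)) ⟩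
    nth (φ* p w) i                            ≡⟨ cong (λ x → nth (φ* p w) (x + r)) (sizes-pos (i + suc k) k (<⇒≤ k<)) ⟨
    nth (φ* p w) (sizes w k + r)              ≡⟨ nth-φ* w k< (subst (λ a → Digit a r b) (v-nth (i + suc k) k<) d) ⟩
    b                                         ∎
    where
    open ≡-Reasoning
    i = pos k + r
    -- This order makes `w` long enough to contain position `k`, and the image of `w` is a later
    -- iterate than the one defining `v i`.
    w = iter p (i + suc k)
    i< : i < length (iter p (suc i))
    i< = ≤-trans (n<1+n i) (<⇒≤ (length-iter (suc i)))
    k< : k < length w
    k< = ≤-trans (m≤n⇒m≤o+n i (n<1+n k)) (<⇒≤ (length-iter (i + suc k)))

  -- ψ i = Ψ(u[0,i)).
  ψ : ℕ → Parikh
  ψ zero    = 0 , 0 , 0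
  ψ (suc i) = ψ i ⊕ letterΨ (v i)

  -- The incidence matrix of φ_p followed by `r` more letters L. Nothing else can follow complete
  -- blocks, because every proper prefix of L^p S, M or L^(p-1) S is a power of L.
  image : Parikh → ℕ → Parikh
  image (l , s , m) r = p * l + suc q * m + r , l + m , s

  image-⊕ : ∀ w r k → image w r ⊕ (k , 0 , 0) ≡ image w (r + k)
  image-⊕ (l , s , m) r k =
    cong₂ _,_ (+-assoc (p * l + suc q * m) r k) (cong₂ _,_ (+-identityʳ (l + m)) (+-identityʳ s))

  ψ-run : ∀ k {r} → (∀ {t} → t < r → v (pos k + t) ≡ L) → ψ (pos k + r) ≡ ψ (pos k) ⊕ (r , 0 , 0)
  ψ-run k {zero}  _   = trans (cong ψ (+-identityʳ (pos k))) (sym (⊕-identityʳ _))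
  ψ-run k {suc r} run = begin
    ψ (pos k + suc r)                              ≡⟨ cong ψ (+-suc (pos k) r) ⟩
    ψ (pos k + r) ⊕ letterΨ (v (pos k + r))        ≡⟨ cong (λ a → ψ (pos k + r) ⊕ letterΨ a) (run ≤-refl) ⟩
    ψ (pos k + r) ⊕ (1 , 0 , 0)                    ≡⟨ cong (_⊕ (1 , 0 , 0)) (ψ-run k (λ t< → run (m≤n⇒m≤1+n t<))) ⟩
    (ψ (pos k) ⊕ (r , 0 , 0)) ⊕ (1 , 0 , 0)        ≡⟨ ⊕-assoc (ψ (pos k)) _ _ ⟩
    ψ (pos k) ⊕ (r + 1 , 0 , 0)                    ≡⟨ cong (λ x → ψ (pos k) ⊕ (x , 0 , 0)) (+-comm r 1) ⟩
    ψ (pos k) ⊕ (suc r , 0 , 0)                    ∎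
    where open ≡-Reasoning

  digit-run : ∀ {a r b} → Digit a r b → ∀ {t} → t < r → Digit a t L
  digit-run (LL r≤) t< = LL (<⇒≤ (<-≤-trans t< r≤))
  digit-run LS (s≤s t≤) = LL t≤
  digit-run (ML r≤) t< = ML (<⇒≤ (<-≤-trans t< r≤))
  digit-run MS (s≤s t≤) = ML t≤

  image-step-L : ∀ w → image (w ⊕ (1 , 0 , 0)) 0 ≡ image w p ⊕ (0 , 1 , 0)
  image-step-L (l , s , m) = cong₂ _,_ (lem q l m) (cong₂ _,_ (lem′ l m) refl)
    where
    lem : ∀ q l m → (2 + q) * (l + 1) + suc q * (m + 0) + 0 ≡ (2 + q) * l + suc q * m + (2 + q) + 0
    lem = ℕ-Solver.solve-∀
    lem′ : ∀ l m → l + 1 + (m + 0) ≡ l + m + 1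
    lem′ = ℕ-Solver.solve-∀

  image-step-M : ∀ w → image (w ⊕ (0 , 0 , 1)) 0 ≡ image w (suc q) ⊕ (0 , 1 , 0)
  image-step-M (l , s , m) = cong₂ _,_ (lem q l m) (cong₂ _,_ (lem′ l m) refl)
    where
    lem : ∀ q l m → (2 + q) * (l + 0) + suc q * (m + 1) + 0 ≡ (2 + q) * l + suc q * m + suc q + 0
    lem = ℕ-Solver.solve-∀
    lem′ : ∀ l m → l + 0 + (m + 1) ≡ l + m + 1
    lem′ = ℕ-Solver.solve-∀

  image-step-S : ∀ w → image (w ⊕ (0 , 1 , 0)) 0 ≡ image w 0 ⊕ (0 , 0 , 1)
  image-step-S (l , s , m) = cong₂ _,_ (lem q l m) (cong₂ _,_ (lem′ l m) refl)
    where
    lem : ∀ q l m → (2 + q) * (l + 0) + suc q * (m + 0) + 0 ≡ (2 + q) * l + suc q * m + 0 + 0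
    lem = ℕ-Solver.solve-∀
    lem′ : ∀ l m → l + 0 + (m + 0) ≡ l + m + 0
    lem′ = ℕ-Solver.solve-∀

  -- Closes the mutual induction below: `ψ-pos` at `suc k` is `ψ-digit` at the last digit of block
  -- `k` plus the final letter of that block, the only letter of a block that can differ from L.
  lastDigit : ∀ a → ∃₂ λ r b → Digit a r b × size a ≡ suc r ×
              (∀ w → image (w ⊕ letterΨ a) 0 ≡ image w r ⊕ letterΨ b)
  lastDigit L = p , S , LS , refl , image-step-L
  lastDigit S = 0 , M , SM , refl , image-step-S
  lastDigit M = suc q , S , MS , refl , image-step-M

  ψ-pos   : ∀ k → ψ (pos k) ≡ image (ψ k) 0
  ψ-digit : ∀ k {r b} → Digit (v k) r b → ψ (pos k + r) ≡ image (ψ k) r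

  ψ-digit k {r} d = trans (ψ-run k (λ t< → v-digit k (digit-run d t<)))
    (trans (cong (_⊕ (r , 0 , 0)) (ψ-pos k)) (image-⊕ (ψ k) 0 r))

  ψ-pos zero    = cong (_, (0 , 0)) (sym (lem q))
    where
    lem : ∀ q → (2 + q) * 0 + suc q * 0 + 0 ≡ 0
    lem = ℕ-Solver.solve-∀
  ψ-pos (suc k) with lastDigit (v k)
  ... | r , b , d , size≡ , step = begin
    ψ (pos k + size (v k))                 ≡⟨ cong (λ x → ψ (pos k + x)) size≡ ⟩
    ψ (pos k + suc r)                      ≡⟨ cong ψ (+-suc (pos k) r) ⟩
    ψ (pos k + r) ⊕ letterΨ (v (pos k + r)) ≡⟨ cong₂ (λ x a → x ⊕ letterΨ a) (ψ-digit k d) (v-digit k d) ⟩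
    image (ψ k) r ⊕ letterΨ b              ≡⟨ step (ψ k) ⟨
    image (ψ k ⊕ letterΨ (v k)) 0          ∎
    where open ≡-Reasoning

  record Parent (i : ℕ) : Set where
    constructor parent
    field
      k r   : ℕ
      digit : Digit (v k) r (v i)
      i≡    : pos k + r ≡ i

  firstDigit : ∀ a → ∃ λ b → Digit a 0 b
  firstDigit L = L , LL z≤n
  firstDigit S = M , SM
  firstDigit M = L , ML z≤n

  firstOfBlock : ∀ k → Digit (v k) 0 (v (pos k))
  firstOfBlock k with firstDigit (v k)
  ... | b , d = subst (Digit (v k) 0) (trans (sym (v-digit k d)) (cong v (+-identityʳ (pos k)))) d

  data Next : Letter → ℕ → Set where
    within : ∀ {a r b} → Digit a (suc r) b → Next a r
    end    : ∀ {a r}   → size a ≡ suc r → Next a r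

  next : ∀ {a r b} → Digit a r b → Next a r
  next (LL r≤) with m≤n⇒m<n∨m≡n r≤
  ... | inj₁ r<   = within (LL r<)
  ... | inj₂ refl = within LS
  next LS = end refl
  next (ML r≤) with m≤n⇒m<n∨m≡n r≤
  ... | inj₁ r<   = within (ML r<)
  ... | inj₂ refl = within MS
  next MS = end refl
  next SM = end refl

  parentOf : ∀ i → Parent i
  parentOf zero    = parent 0 0 (firstOfBlock 0) refl
  parentOf (suc i) with parentOf i
  ... | parent k r d refl with next d
  ...   | within d′ = parent k (suc r) (subst (Digit (v k) (suc r)) (trans (sym (v-digit k d′)) (cong v (+-suc (pos k) r))) d′) (+-suc (pos k) r)
  ...   | end size≡ = parent (suc k) 0 (subst (λ x → Digit (v (suc k)) 0 (v x)) pos≡ (firstOfBlock (suc k))) (trans (+-identityʳ _) pos≡)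
    where
    pos≡ : pos (suc k) ≡ suc (pos k + r)
    pos≡ = trans (cong (_+_ (pos k)) size≡) (+-suc (pos k) r)

  ∣⊕∣ : ∀ w x → ∣ w ⊕ x ∣ₚ ≡ ∣ w ∣ₚ + ∣ x ∣ₚ
  ∣⊕∣ (l , s , m) (l′ , s′ , m′) = lem l s m l′ s′ m′
    where
    lem : ∀ l s m l′ s′ m′ → l + l′ + (s + s′) + (m + m′) ≡ l + s + m + (l′ + s′ + m′)
    lem = ℕ-Solver.solve-∀

  ∣letterΨ∣ : ∀ a → ∣ letterΨ a ∣ₚ ≡ 1
  ∣letterΨ∣ L = refl
  ∣letterΨ∣ S = refl
  ∣letterΨ∣ M = refl

  ∣ψ∣ : ∀ i → ∣ ψ i ∣ₚ ≡ i
  ∣ψ∣ zero    = refl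
  ∣ψ∣ (suc i) = trans (∣⊕∣ (ψ i) (letterΨ (v i)))
    (trans (cong₂ _+_ (∣ψ∣ i) (∣letterΨ∣ (v i))) (+-comm i 1))

  ψ-factor : ∀ i n → ψ (i + n) ≡ ψ i ⊕ factorΨ v i n
  ψ-factor i zero    = trans (cong ψ (+-identityʳ i)) (sym (⊕-identityʳ (ψ i)))
  ψ-factor i (suc n) = trans (cong ψ (+-suc i n)) (trans (ψ-factor (suc i) n) (⊕-assoc (ψ i) (letterΨ (v i)) _))

  ∣factorΨ∣ : ∀ i n → ∣ factorΨ v i n ∣ₚ ≡ n
  ∣factorΨ∣ i zero    = refl
  ∣factorΨ∣ i (suc n) = trans (∣⊕∣ (letterΨ (v i)) _) (cong₂ _+_ (∣letterΨ∣ (v i)) (∣factorΨ∣ (suc i) n))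

  -- Bounded recurrence of windows

  pos-mono-≤ : ∀ {j k} → j ≤ k → pos j ≤ pos k
  pos-mono-≤ {j} {k} j≤k with m≤n⇒∃[o]m+o≡n j≤k
  ... | d , refl = go d
    where
    go : ∀ d → pos j ≤ pos (j + d)
    go zero    = ≤-reflexive (cong pos (sym (+-identityʳ j)))
    go (suc d) = ≤-trans (go d) (≤-trans (m≤m+n (pos (j + d)) _) (≤-reflexive (cong pos (sym (+-suc j d)))))

  digitAt : ∀ {a r} → r < size a → ∃ λ b → Digit a r b
  digitAt {L} (s≤s r≤p) with m≤n⇒m<n∨m≡n r≤p
  ... | inj₁ (s≤s r≤) = L , LL r≤
  ... | inj₂ refl     = S , LS
  digitAt {S} (s≤s z≤n) = M , SM
  digitAt {M} (s≤s r≤p) with m≤n⇒m<n∨m≡n r≤p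
  ... | inj₁ (s≤s r≤) = L , ML r≤
  ... | inj₂ refl     = S , MS

  -- The length of φ_p(u[k,k+n)). Unlike `pos`, it depends only on the letters of the window, so
  -- equal windows have equal spans.
  span : ℕ → ℕ → ℕ
  span k zero    = 0
  span k (suc n) = span k n + size (v (k + n))

  pos-span : ∀ k n → pos (k + n) ≡ pos k + span k n
  pos-span k zero    = trans (cong pos (+-identityʳ k)) (sym (+-identityʳ (pos k)))
  pos-span k (suc n) = trans (cong pos (+-suc k n))
    (trans (cong (_+ size (v (k + n))) (pos-span k n)) (+-assoc (pos k) (span k n) _))

  span-agree : ∀ n k k′ → Agree v n k k′ → span k n ≡ span k′ n
  span-agree zero    k k′ agree = refl
  span-agree (suc n) k k′ agree = cong₂ _+_ (span-agree n k k′ (Agree-≤ {v} k k′ (n≤1+n n) agree)) (cong size (agree ≤-refl))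

  locate : ∀ k n {t} → t < span k n → ∃₂ λ x r → x < n × t ≡ span k x + r × r < size (v (k + x))
  locate k (suc n) {t} t< with <-≤-connex t (span k n)
  ... | inj₁ t<span with x , r , x<n , rest ← locate k n t<span = x , r , m≤n⇒m≤1+n x<n , rest
  ... | inj₂ span≤t = n , t ∸ span k n , ≤-refl , sym (m+[n∸m]≡n span≤t) ,
    +-cancelˡ-< (span k n) _ _ (subst (_< span k n + size (v (k + n))) (sym (m+[n∸m]≡n span≤t)) t<)

  v-span : ∀ k x {r b} → Digit (v (k + x)) r b → v (pos k + (span k x + r)) ≡ b
  v-span k x {r} d = trans (cong v (trans (sym (+-assoc (pos k) (span k x) r)) (cong (_+ r) (sym (pos-span k x)))))
    (v-digit (k + x) d)

  image-agree : ∀ n k k′ → Agree v n k k′ → Agree v (span k n) (pos k) (pos k′)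
  image-agree n k k′ agree t< with locate k n t<
  ... | x , r , x<n , refl , r< with digitAt r<
  ...   | b , d = trans (v-span k x d) (sym (trans (cong (λ y → v (pos k′ + (y + r))) (span-agree x k k′ (Agree-≤ {v} k k′ (<⇒≤ x<n) agree)))
                    (v-span k′ x (subst (λ a → Digit a r b) (agree x<n) d))))

  S-first : ∀ k → v (pos k) ≢ S
  S-first k eq with v k | firstOfBlock k
  ... | L | d rewrite eq with () ← d
  ... | S | d rewrite eq with () ← d
  ... | M | d rewrite eq with () ← d

  after-S : ∀ {i} → v i ≡ S → ∃ λ k → suc i ≡ pos k
  after-S {i} eq with parentOf i
  ... | parent k r d refl = suc k , trans (sym (+-suc (pos k) r)) (cong (_+_ (pos k)) (lem (subst (Digit (v k) r) eq d)))
    where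
    lem : ∀ {a r} → Digit a r S → suc r ≡ size a
    lem LS = refl
    lem MS = refl

  -- S occurs only as the last letter of a block, and no block begins with S.
  SS-free : ∀ {i} → v i ≡ S → v (suc i) ≢ S
  SS-free {i} vi≡S with k , eq ← after-S {i} vi≡S = S-first k ∘ trans (cong v (sym eq))

  first-L : ∀ {k} → v k ≢ S → v (pos k) ≡ L
  first-L {k} ≢S with v k | firstOfBlock k
  ... | L | d with v (pos k) | d
  ...   | _ | LL _ = refl
  first-L {k} ≢S | S | d = contradiction refl ≢S
  first-L {k} ≢S | M | d with v (pos k) | d
  ...   | _ | ML _ = refl

  -- If the last letter of a window is S, then its image is followed by the image of L or M, hence by L.
  image-agree⁺ : ∀ n k k′ → Agree v (suc n) k k′ → v (k + n) ≡ S →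
                 Agree v (suc (span k (suc n))) (pos k) (pos k′)
  image-agree⁺ n k k′ agree last≡S {t} (s≤s t≤) with m≤n⇒m<n∨m≡n t≤
  ... | inj₁ t<   = image-agree (suc n) k k′ agree t<
  ... | inj₂ refl = trans (follows k last≡S) (sym (trans (cong (λ y → v (pos k′ + y)) (span-agree (suc n) k k′ agree))
                      (follows k′ (trans (sym (agree ≤-refl)) last≡S))))
    where
    follows : ∀ k → v (k + n) ≡ S → v (pos k + span k (suc n)) ≡ L
    follows k eq = trans (cong v (sym (pos-span k (suc n)))) (first-L {k + suc n} (subst (λ y → v y ≢ S) (sym (+-suc k n)) (SS-free {k + n} eq)))

  n≤span : ∀ k n → n ≤ span k n
  n≤span k zero    = z≤n
  n≤span k (suc n) = ≤-trans (≤-reflexive (+-comm 1 n)) (+-mono-≤ (n≤span k n) (1≤size (v (k + n))))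

  span-suc : ∀ k n → span k (suc n) ≡ size (v k) + span (suc k) n
  span-suc k zero    = trans (cong (size ∘ v) (+-identityʳ k)) (sym (+-identityʳ _))
  span-suc k (suc n) = trans (cong₂ _+_ (span-suc k n) (cong (size ∘ v) (+-suc k n))) (+-assoc (size (v k)) _ _)

  -- Each inner letter of the window has a nonempty image, and a last letter L or M contributes at
  -- least two letters, which yields the extra one. A last letter S contributes M alone; the missing
  -- letter is then the L provided by `image-agree⁺`.
  grow : ∀ n k k′ → Agree v (2 + n) k k′ → ∀ {r} → r < size (v k) → Agree v (3 + n) (pos k + r) (pos k′ + r)
  grow n k k′ agree {r} r< {t} t< =
    trans (cong v (+-assoc (pos k) r t)) (trans (go (v (k + suc n)) refl) (cong v (sym (+-assoc (pos k′) r t))))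
    where
    r+t< : r + t < size (v k) + (2 + n)
    r+t< = +-mono-<-≤ r< (s≤s⁻¹ t<)
    before : span k (2 + n) ≡ size (v k) + (span (suc k) n + size (v (k + suc n)))
    before = trans (span-suc k (suc n)) (cong (λ y → size (v k) + (span (suc k) n + size (v y))) (sym (+-suc k n)))
    long : ∀ {a} → 2 ≤ size a → v (k + suc n) ≡ a → v (pos k + (r + t)) ≡ v (pos k′ + (r + t))
    long {a} 2≤ eq = image-agree (2 + n) k k′ agree (<-≤-trans r+t< (begin
      size (v k) + (2 + n)                                     ≤⟨ +-monoʳ-≤ (size (v k)) (≤-trans (≤-reflexive (+-comm 2 n)) (+-mono-≤ (n≤span (suc k) n) 2≤)) ⟩
      size (v k) + (span (suc k) n + size a)                   ≡⟨ cong (λ a → size (v k) + (span (suc k) n + size a)) eq ⟨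
      size (v k) + (span (suc k) n + size (v (k + suc n)))     ≡⟨ before ⟨
      span k (2 + n)                                           ∎))
      where open ≤-Reasoning
    go : ∀ a → v (k + suc n) ≡ a → v (pos k + (r + t)) ≡ v (pos k′ + (r + t))
    go S eq = image-agree⁺ (suc n) k k′ agree eq (<-≤-trans r+t< (begin
      size (v k) + (2 + n)                                     ≤⟨ +-monoʳ-≤ (size (v k)) (s≤s (≤-trans (s≤s (n≤span (suc k) n)) (≤-reflexive (+-comm 1 _)))) ⟩
      size (v k) + suc (span (suc k) n + size S)               ≡⟨ +-suc (size (v k)) _ ⟩
      suc (size (v k) + (span (suc k) n + size S))             ≡⟨ cong (λ a → suc (size (v k) + (span (suc k) n + size a))) eq ⟨
      suc (size (v k) + (span (suc k) n + size (v (k + suc n)))) ≡⟨ cong suc before ⟨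
      suc (span k (2 + n))                                     ∎))
      where open ≤-Reasoning
    go L eq = long (s≤s (s≤s z≤n)) eq
    go M eq = long (s≤s (s≤s z≤n)) eq

  data Adjacent : Letter → Letter → Set where
    LL : Adjacent L L
    LS : Adjacent L S
    SL : Adjacent S L
    SM : Adjacent S M
    ML : Adjacent M L

  after-digit : ∀ k {r b} → Digit (v k) (suc r) b → v (suc (pos k + r)) ≡ b
  after-digit k {r} d = trans (cong v (sym (+-suc (pos k) r))) (v-digit k d)

  after-block : ∀ k {r} → size (v k) ≡ suc r → v (suc (pos k + r)) ≡ v (pos (suc k))
  after-block k {r} size≡ = cong v (trans (sym (+-suc (pos k) r)) (cong (_+_ (pos k)) (sym size≡)))

  adjacent : ∀ i → Adjacent (v i) (v (suc i))
  adjacent i with parentOf i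
  ... | parent k r d refl = go k (v k) refl d
    where
    L-next : ∀ {b} → b ≢ M → Adjacent L b
    L-next {L} _  = LL
    L-next {S} _  = LS
    L-next {M} ≢M = contradiction refl ≢M
    S-next : ∀ {b} → b ≢ S → Adjacent S b
    S-next {L} _  = SL
    S-next {S} ≢S = contradiction refl ≢S
    S-next {M} _  = SM
    L-run : ∀ {a r b} → Digit a (suc r) b → b ≢ M
    L-run (LL _) ()
    L-run LS ()
    L-run (ML _) ()
    L-run MS ()
    ends : ∀ k {a r} → v k ≡ a → size a ≡ suc r → v (suc (pos k + r)) ≢ S
    ends k refl size≡ = S-first (suc k) ∘ trans (sym (after-block k size≡))
    go : ∀ k a {b r} → v k ≡ a → Digit a r b → Adjacent b (v (suc (pos k + r)))
    run : ∀ k {a r b} → v k ≡ a → Digit a (suc r) b → Adjacent L (v (suc (pos k + r)))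
    run k eq d = L-next (subst (_≢ M) (sym (after-digit k (subst (λ a → Digit a _ _) (sym eq) d))) (L-run d))
    go k .L eq (LL r≤) with m≤n⇒m<n∨m≡n r≤
    ... | inj₁ r<   = run k eq (LL r<)
    ... | inj₂ refl = run k eq LS
    go k .M eq (ML r≤) with m≤n⇒m<n∨m≡n r≤
    ... | inj₁ r<   = run k eq (ML r<)
    ... | inj₂ refl = run k eq MS
    go k .L eq LS = S-next (ends k eq refl)
    go k .M eq MS = S-next (ends k eq refl)
    go k .S eq SM = subst (Adjacent M) (sym (trans (after-block k (cong size eq)) (first-L {suc k} (SS-free {k} eq)))) ML

  v-early : ∀ {r} → r ≤ suc q → v r ≡ L
  v-early r≤ = v-digit 0 (LL r≤)

  v-p : v p ≡ S
  v-p = v-digit 0 LS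

  v-1+p : v (suc p) ≡ L
  v-1+p = first-L {1} (λ v1≡S → contradiction (trans (sym (v-early (s≤s z≤n))) v1≡S) λ ())

  -- The prefix L^p S L of u has an image beginning with (L^p S)^p M L, and all five pairs occur
  -- there. The M stands at `pos p`, which explains the bound.
  occurrence : ∀ {a b} → Adjacent a b → ∃ λ i → i < suc (pos p) × v i ≡ a × v (suc i) ≡ b
  occurrence LL = 0 , s≤s z≤n , refl , v-early (s≤s z≤n)
  occurrence LS = suc q , s≤s (≤-trans (n≤1+n _) p≤pos-p) , v-early ≤-refl , v-p
    where
    p≤pos-p : p ≤ pos p
    p≤pos-p = ≤-trans (n≤span 0 p) (≤-reflexive (sym (pos-span 0 p)))
  occurrence SL = p , s≤s (≤-trans (n≤span 0 p) (≤-reflexive (sym (pos-span 0 p)))) , v-p , v-1+p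
  occurrence SM = pos (suc q) + p , s≤s (+-monoʳ-≤ (pos (suc q)) (≤-trans (n≤1+n p) (≤-reflexive (sym size≡)))) ,
    v-digit (suc q) (subst (λ a → Digit a p S) (sym (v-early ≤-refl)) LS) ,
    trans (after-block (suc q) size≡) (trans (cong v (sym (+-identityʳ (pos p)))) (v-digit p (subst (λ a → Digit a 0 M) (sym v-p) SM)))
    where
    size≡ : size (v (suc q)) ≡ suc p
    size≡ = cong size (v-early ≤-refl)
  occurrence ML = pos p , ≤-refl , trans (cong v (sym (+-identityʳ (pos p)))) (v-digit p (subst (λ a → Digit a 0 M) (sym v-p) SM)) ,
    trans (cong v (trans (+-comm 1 (pos p)) (cong (λ a → pos p + size a) (sym v-p)))) (first-L {suc p} (SS-free {p} v-p))

  Windows : ℕ → Set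
  Windows n = ∃ λ B → ∀ i → ∃ λ i′ → i′ < B × Agree v n i i′

  -- A window of length 3 + n starts inside the block of some letter `k`, and it is copied by
  -- replacing the window at `k` with an earlier occurrence. The induction cannot start from single
  -- letters: the S ending a block may be followed by L or by M.
  windows : ∀ n → Windows (2 + n)
  windows zero = suc (pos p) , λ i → pairs i (occurrence (adjacent i))
    where
    pairs : ∀ i → (∃ λ i′ → i′ < suc (pos p) × v i′ ≡ v i × v (suc i′) ≡ v (suc i)) → ∃ λ i′ → i′ < suc (pos p) × Agree v 2 i i′
    pairs i (i′ , i′< , eq₀ , eq₁) = i′ , i′< , agree
      where
      agree : Agree v 2 i i′
      agree {zero}     _ = trans (cong v (+-identityʳ i)) (trans (sym eq₀) (cong v (sym (+-identityʳ i′))))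
      agree {suc zero} _ = trans (cong v (+-comm i 1)) (trans (sym eq₁) (cong v (+-comm 1 i′)))
      agree {suc (suc t)} (s≤s (s≤s ()))
  windows (suc n) with windows n
  ... | B , bounded = pos B , λ i → go i (parentOf i)
    where
    go : ∀ i → Parent i → ∃ λ i′ → i′ < pos B × Agree v (3 + n) i i′
    go i (parent k r d refl) with bounded k
    ... | k′ , k′<B , agree = pos k′ + r , <-≤-trans (+-monoʳ-< (pos k′) (subst (λ a → r < size a) same (digit<size d))) (pos-mono-≤ k′<B) ,
          grow n k k′ agree (digit<size d)
      where
      same : v k ≡ v k′
      same = trans (cong v (sym (+-identityʳ k))) (trans (agree (s≤s z≤n)) (cong v (+-identityʳ k′)))

  recurrent : Recurrent v
  recurrent n with windows n
  ... | B , bounded = B , λ i → let i′ , i′<B , agree = bounded i in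
          i′ , i′<B , factorΨ-agree {v} n (Agree-≤ {v} i i′ (m≤n+m n 2) agree)

-- A finite automaton of Parikh differences

infixr 4 _⇒_
_⇒_ : Bool → Bool → Bool
x ⇒ y = if x then y else true

data Pair : Set where
  ⟪LL⟫ ⟪LS⟫ ⟪LM⟫ ⟪SS⟫ ⟪SM⟫ ⟪MM⟫ : Pair

pair : Letter → Letter → Pair
pair L L = ⟪LL⟫
pair L S = ⟪LS⟫
pair L M = ⟪LM⟫
pair S L = ⟪LS⟫
pair S S = ⟪SS⟫
pair S M = ⟪SM⟫
pair M L = ⟪LM⟫
pair M S = ⟪SM⟫
pair M M = ⟪MM⟫

rep : Pair → Letter × Letter
rep ⟪LL⟫ = L , L
rep ⟪LS⟫ = L , S
rep ⟪LM⟫ = L , M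
rep ⟪SS⟫ = S , S
rep ⟪SM⟫ = S , M
rep ⟪MM⟫ = M , M

pairCode : Pair → ℕ
pairCode ⟪LL⟫ = 0
pairCode ⟪LS⟫ = 1
pairCode ⟪LM⟫ = 2
pairCode ⟪SS⟫ = 3
pairCode ⟪SM⟫ = 4
pairCode ⟪MM⟫ = 5

-- The state of four positions h, i, j, k: s, m and k are the differences #S, #M and length of
-- ψ h + ψ i - ψ j - ψ k, and A = {u h , u i}, B = {u j , u k} as unordered pairs.
record State : Set where
  constructor state
  field
    s m k : ℤ
    A B   : Pair

data Trie : Set where
  leaf : Trie
  node : Maybe State → Trie → Trie → Trie

-- The path of a key is given by its binary digits, starting from the least significant one.
insert : ℕ → ℕ → State → Trie → Trie
insert zero    n x leaf         = node (just x) leaf leaf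
insert zero    n x (node _ l r) = node (just x) l r
insert (suc d) n x leaf         = if n % 2 ≡ᵇ 0 then node nothing (insert d (n / 2) x leaf) leaf
                                                else node nothing leaf (insert d (n / 2) x leaf)
insert (suc d) n x (node y l r) = if n % 2 ≡ᵇ 0 then node y (insert d (n / 2) x l) r
                                                else node y l (insert d (n / 2) x r)

find : ℕ → ℕ → Trie → Maybe State
find _       n leaf         = nothing
find zero    n (node x _ _) = x
find (suc d) n (node _ l r) = if n % 2 ≡ᵇ 0 then find d (n / 2) l else find d (n / 2) r

-- (c , d) stands for the affine function c + d t of a parameter t ≥ 0, where p = 2 + q₀ + σ t.
Form : Set
Form = ℤ × ℤ

infixl 6 _⊞_ _⊟_
_⊞_ _⊟_ : Form → Form → Form
(c , d) ⊞ (c′ , d′) = c ℤ.+ c′ , d ℤ.+ d′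
(c , d) ⊟ (c′ , d′) = c ℤ.- c′ , d ℤ.- d′

infixl 7 _⊠_
_⊠_ : ℤ → Form → Form
x ⊠ (c , d) = x ℤ.* c , x ℤ.* d

const : ℤ → Form
const c = c , 0ℤ

-- Bounds valid for all t ≥ 0 at once, cut off at ±5.
lower upper : Form → ℤ
lower (c , d) = if 0ℤ ℤ.≤ᵇ d then c ℤ.⊔ -[1+ 4 ] else -[1+ 4 ]
upper (c , d) = if d ℤ.≤ᵇ 0ℤ then c ℤ.⊓ + 5 else + 5

-- A mixed-radix number, injective for s and m in [-8,7] and k in [-5,5]. In that range it stays
-- below 16 * 16 * 11 * 36 < 2^17, so tries of depth 18 lose nothing.
code : State → ℕ
code (state s m k A B) =
  ((((∣ s ℤ.+ + 8 ∣ * 16) + ∣ m ℤ.+ + 8 ∣) * 11 + ∣ k ℤ.+ + 5 ∣) * 6 + pairCode A) * 6 + pairCode B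

upFrom : ℕ → ℤ → List ℤ
upFrom zero    x = []
upFrom (suc n) x = x ∷ upFrom n (x ℤ.+ 1ℤ)

between : ℤ → ℤ → List ℤ
between lo hi = if lo ℤ.≤ᵇ hi then upFrom (suc ∣ hi ℤ.- lo ∣) lo else []

_==_ : State → State → Bool
state s m k A B == state s′ m′ k′ A′ B′ =
  (∣ s ℤ.- s′ ∣ ≡ᵇ 0) ∧ (∣ m ℤ.- m′ ∣ ≡ᵇ 0) ∧ (∣ k ℤ.- k′ ∣ ≡ᵇ 0) ∧ (pairCode A ≡ᵇ pairCode A′) ∧ (pairCode B ≡ᵇ pairCode B′)

-- Stored states are compared with the query, so code need not be injective.
contains : Trie → State → Bool
contains t x with find 18 (code x) t
... | just y  = x == y
... | nothing = false

everywhere : (State → Bool) → Trie → Bool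
everywhere f leaf                = true
everywhere f (node nothing  l r) = everywhere f l ∧ everywhere f r
everywhere f (node (just x) l r) = f x ∧ everywhere f l ∧ everywhere f r

module Automaton (q₀ σ : ℕ) where

  P : Form
  P = + (2 + q₀) , + σ

  -- An entry is the letter read together with the least and the greatest digit at which it is read.
  -- A whole run of L is one entry with affine ends, which keeps the table finite uniformly in p.
  digits : Letter → List (Letter × Form × Form)
  digits L = (L , const 0ℤ , P ⊟ const 1ℤ) ∷ (S , P , P) ∷ []
  digits S = (M , const 0ℤ , const 0ℤ) ∷ []
  digits M = (L , const 0ℤ , P ⊟ const (+ 2)) ∷ (S , P ⊟ const 1ℤ , P ⊟ const 1ℤ) ∷ []

  digits₂ : Pair → List (Pair × Form × Form)
  digits₂ A = concatMap (λ (a , lo , hi) → map (λ (a′ , lo′ , hi′) → pair a a′ , lo ⊞ lo′ , hi ⊞ hi′)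
    (digits (proj₂ (rep A)))) (digits (proj₁ (rep A)))

  -- The image of an interval with difference (s , m , k) under φ_p has length p (k - s) + (k - m).
  base : State → Form
  base (state s m k _ _) = (k ℤ.- s) ⊠ P ⊞ const (k ℤ.- m)

  -- Each of L and M has exactly one S in its image, and only S has an M there: so (s , m) becomes
  -- (k - s , s). The new length difference is only confined to an interval valid for all
  -- parameters, so unreachable states may be included; this is harmless as long as the checks
  -- succeed on them.
  children : State → List State
  children st@(state s m k A B) =
    concatMap (λ (A′ , lo , hi) → concatMap (λ (B′ , lo′ , hi′) →
      map (λ x → state (k ℤ.- s) s x A′ B′)
        (between (lower (base st ⊞ lo ⊟ hi′)) (upper (base st ⊞ hi ⊟ lo′))))
      (digits₂ B)) (digits₂ A)

  root : State
  root = state 0ℤ 0ℤ 0ℤ ⟪LL⟫ ⟪LL⟫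

  top : Letter → Form
  top L = P
  top S = const 0ℤ
  top M = P ⊟ const 1ℤ

  -- A pair of factors whose lengths differ by 5 has descendants whose lengths differ by at least 5; top
  -- accounts for the largest digits of the shorter factor.
  exits : State → Bool
  exits st@(state _ _ k _ B) = (k ℤ.≤ᵇ + 4) ∨ above (base st ⊟ top (proj₁ (rep B)) ⊟ top (proj₂ (rep B)))
    where
    above : Form → Bool
    above (x , y) = (+ 5 ℤ.≤ᵇ x) ∧ (0ℤ ℤ.≤ᵇ y)

  -- Two factors of equal length always give k = 0. States with other k are kept only because they
  -- occur as ancestors of such states.
  separated : State → Bool
  separated (state s m k _ _) =
    (∣ k ∣ ≡ᵇ 0) ∧ (∣ + 3 ℤ.* s ℤ.+ m ∣ % 7 ≡ᵇ 0) ⇒ (∣ s ∣ ≡ᵇ 0) ∧ (∣ m ∣ ≡ᵇ 0)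

  -- No property of explore is needed: its result is checked by valid.
  explore : ℕ → List State → Trie → Trie
  explore zero    _        t = t
  explore (suc n) []       t = t
  explore (suc n) (x ∷ xs) t with find 18 (code x) t
  ... | just _  = explore n xs t
  ... | nothing = explore n (children x ++ xs) (insert 18 (code x) x t)

  good : Trie → State → Bool
  good t st = all (contains t) (children st) ∧ exits st ∧ separated st

  valid : Trie → Bool
  valid t = contains t root ∧ everywhere (good t) t

  reached : Trie
  reached = explore 100000 [ root ] leaf

  -- The trie is an abstract field, so the soundness proof sees only the Boolean equation, and the
  -- search is evaluated only where a certificate is built.
  record Certificate : Set where
    field
      trie   : Trie
      valid≡ : valid trie ≡ true

-- Correctness of the Boolean checks and of the affine bounds

T-∧⁻ : ∀ {x y} → T (x ∧ y) → T x × T y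
T-∧⁻ = Equivalence.to T-∧

∈-concatMap : ∀ {A B : Set} {f : A → List B} {xs x y} → x ∈ xs → y ∈ f x → y ∈ concatMap f xs
∈-concatMap x∈xs y∈fx = ∈-concatMap⁺ _ (lose x∈xs y∈fx)

rep-pair : ∀ a b → rep (pair a b) ≡ (a , b) ⊎ rep (pair a b) ≡ (b , a)
rep-pair L L = inj₁ refl
rep-pair L S = inj₁ refl
rep-pair L M = inj₁ refl
rep-pair S L = inj₂ refl
rep-pair S S = inj₁ refl
rep-pair S M = inj₁ refl
rep-pair M L = inj₂ refl
rep-pair M S = inj₂ refl
rep-pair M M = inj₁ refl

pair-comm : ∀ a b → pair a b ≡ pair b a
pair-comm L L = refl
pair-comm L S = refl
pair-comm L M = refl
pair-comm S L = refl
pair-comm S S = refl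
pair-comm S M = refl
pair-comm M L = refl
pair-comm M S = refl
pair-comm M M = refl

pairCode-injective : ∀ A B → pairCode A ≡ pairCode B → A ≡ B
pairCode-injective ⟪LL⟫ ⟪LL⟫ _ = refl
pairCode-injective ⟪LS⟫ ⟪LS⟫ _ = refl
pairCode-injective ⟪LM⟫ ⟪LM⟫ _ = refl
pairCode-injective ⟪SS⟫ ⟪SS⟫ _ = refl
pairCode-injective ⟪SM⟫ ⟪SM⟫ _ = refl
pairCode-injective ⟪MM⟫ ⟪MM⟫ _ = refl

∈-upFrom : ∀ n x {e} → e < n → (x ℤ.+ + e) ∈ upFrom n x
∈-upFrom (suc n) x {zero}  _         = here (ℤₚ.+-identityʳ x)
∈-upFrom (suc n) x {suc e} (s≤s e<n) =
  there (subst (_∈ upFrom n (x ℤ.+ 1ℤ)) (ℤₚ.+-assoc x 1ℤ (+ e)) (∈-upFrom n (x ℤ.+ 1ℤ) e<n))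

∈-between : ∀ {lo hi x} → lo ℤ.≤ x → x ℤ.≤ hi → x ∈ between lo hi
∈-between {lo} {hi} {x} lo≤x x≤hi with lo ℤ.≤ᵇ hi | ℤₚ.≤⇒≤ᵇ (ℤₚ.≤-trans lo≤x x≤hi)
... | true | _ = subst (_∈ upFrom (suc ∣ hi ℤ.- lo ∣) lo) x≡ (∈-upFrom _ lo (s≤s d≤))
  where
  d≡ : x ℤ.- lo ≡ + ∣ x ℤ.- lo ∣
  d≡ = sym (ℤₚ.0≤i⇒+∣i∣≡i (ℤₚ.i≤j⇒0≤j-i lo≤x))
  d≤ : ∣ x ℤ.- lo ∣ ≤ ∣ hi ℤ.- lo ∣
  d≤ = ℤₚ.drop‿+≤+ (subst₂ ℤ._≤_ d≡ (sym (ℤₚ.0≤i⇒+∣i∣≡i (ℤₚ.i≤j⇒0≤j-i (ℤₚ.≤-trans lo≤x x≤hi))))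
                      (ℤₚ.+-monoˡ-≤ (ℤ.- lo) x≤hi))
  cancel : ∀ lo x → lo ℤ.+ (x ℤ.- lo) ≡ x
  cancel = ℤ-Solver.solve-∀
  x≡ : lo ℤ.+ + ∣ x ℤ.- lo ∣ ≡ x
  x≡ = trans (cong (ℤ._+_ lo) (sym d≡)) (cancel lo x)

∣i-j∣≡0⇒i≡j : ∀ i j → T (∣ i ℤ.- j ∣ ≡ᵇ 0) → i ≡ j
∣i-j∣≡0⇒i≡j i j eq = ℤₚ.i-j≡0⇒i≡j i j (ℤₚ.∣i∣≡0⇒i≡0 (≡ᵇ⇒≡ _ 0 eq))

i-k≤j-l : ∀ {i j k l} → i ℤ.≤ j → l ℤ.≤ k → i ℤ.- k ℤ.≤ j ℤ.- l
i-k≤j-l i≤j l≤k = ℤₚ.+-mono-≤ i≤j (ℤₚ.neg-mono-≤ l≤k)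

T-⇒ : ∀ {x y} → T (x ⇒ y) → T x → T y
T-⇒ {true} y _ = y

everywhere-find : ∀ {f} d n t {x} → T (everywhere f t) → find d n t ≡ just x → T (f x)
everywhere-find {f} zero    n (node (just x) l r) ok refl = proj₁ (T-∧⁻ {f x} ok)
everywhere-find {f} (suc d) n (node y l r) ok eq with split y ok
  where
  split : ∀ y → T (everywhere f (node y l r)) → T (everywhere f l) × T (everywhere f r)
  split nothing  ok = T-∧⁻ {everywhere f l} ok
  split (just x) ok = T-∧⁻ {everywhere f l} (proj₂ (T-∧⁻ {f x} ok))
... | okˡ , okʳ with n % 2 ≡ᵇ 0
...   | true  = everywhere-find d _ l okˡ eq
...   | false = everywhere-find d _ r okʳ eq

==⇒≡ : ∀ x y → T (x == y) → x ≡ y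
==⇒≡ (state s m k A B) (state s′ m′ k′ A′ B′) eq
  with eq₁ , eq ← T-∧⁻ {∣ s ℤ.- s′ ∣ ≡ᵇ 0} eq
  with eq₂ , eq ← T-∧⁻ {∣ m ℤ.- m′ ∣ ≡ᵇ 0} eq
  with eq₃ , eq ← T-∧⁻ {∣ k ℤ.- k′ ∣ ≡ᵇ 0} eq
  with eq₄ , eq₅ ← T-∧⁻ {pairCode A ≡ᵇ pairCode A′} eq
  with refl ← ∣i-j∣≡0⇒i≡j s s′ eq₁
     | refl ← ∣i-j∣≡0⇒i≡j m m′ eq₂
     | refl ← ∣i-j∣≡0⇒i≡j k k′ eq₃
     | refl ← pairCode-injective A A′ (≡ᵇ⇒≡ _ _ eq₄)
     | refl ← pairCode-injective B B′ (≡ᵇ⇒≡ _ _ eq₅) = refl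

contains-everywhere : ∀ {f} t x → T (everywhere f t) → T (contains t x) → T (f x)
contains-everywhere t x ok x∈t with find 18 (code x) t in eq
... | just y with refl ← ==⇒≡ x y x∈t = everywhere-find 18 (code x) t ok eq

⟦_⟧ : Form → ℕ → ℤ
⟦ c , d ⟧ t = c ℤ.+ d ℤ.* + t

⟦⊞⟧ : ∀ f g t → ⟦ f ⊞ g ⟧ t ≡ ⟦ f ⟧ t ℤ.+ ⟦ g ⟧ t
⟦⊞⟧ (c , d) (c′ , d′) t = lem c d c′ d′ (+ t)
  where
  lem : ∀ c d c′ d′ t → c ℤ.+ c′ ℤ.+ (d ℤ.+ d′) ℤ.* t ≡ c ℤ.+ d ℤ.* t ℤ.+ (c′ ℤ.+ d′ ℤ.* t)
  lem = ℤ-Solver.solve-∀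

⟦⊟⟧ : ∀ f g t → ⟦ f ⊟ g ⟧ t ≡ ⟦ f ⟧ t ℤ.- ⟦ g ⟧ t
⟦⊟⟧ (c , d) (c′ , d′) t = lem c d c′ d′ (+ t)
  where
  lem : ∀ c d c′ d′ t → c ℤ.- c′ ℤ.+ (d ℤ.- d′) ℤ.* t ≡ c ℤ.+ d ℤ.* t ℤ.- (c′ ℤ.+ d′ ℤ.* t)
  lem = ℤ-Solver.solve-∀

⟦⊠⟧ : ∀ x f t → ⟦ x ⊠ f ⟧ t ≡ x ℤ.* ⟦ f ⟧ t
⟦⊠⟧ x (c , d) t = lem x c d (+ t)
  where
  lem : ∀ x c d t → x ℤ.* c ℤ.+ x ℤ.* d ℤ.* t ≡ x ℤ.* (c ℤ.+ d ℤ.* t)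
  lem = ℤ-Solver.solve-∀

⟦const⟧ : ∀ c t → ⟦ const c ⟧ t ≡ c
⟦const⟧ c t = ℤₚ.+-identityʳ c

lower≤ : ∀ f {t x} → ⟦ f ⟧ t ℤ.≤ x → -[1+ 4 ] ℤ.≤ x → lower f ℤ.≤ x
lower≤ (c , + d)      {t} fx 5x = ℤₚ.⊔-lub (ℤₚ.≤-trans (ℤₚ.≤-trans (ℤₚ.i≤i+j c (+ (d * t)))
  (ℤₚ.≤-reflexive (cong (ℤ._+_ c) (ℤₚ.pos-* d t)))) fx) 5x
lower≤ (c , -[1+ d ])     fx 5x = 5x

≤upper : ∀ f {t x} → x ℤ.≤ ⟦ f ⟧ t → x ℤ.≤ + 5 → x ℤ.≤ upper f
≤upper (c , + zero)    {t} xf x5 = ℤₚ.⊓-glb (ℤₚ.≤-trans xf (ℤₚ.≤-reflexive (ℤₚ.+-identityʳ c))) x5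
≤upper (c , + suc d)       xf x5 = x5
≤upper (c , -[1+ d ])  {t} xf x5 = ℤₚ.⊓-glb (ℤₚ.≤-trans xf (ℤₚ.≤-trans
  (ℤₚ.+-monoʳ-≤ c (ℤₚ.≤-trans (ℤₚ.*-monoʳ-≤-nonNeg (+ t) (ℤ.-≤+ {d} {0})) (ℤₚ.≤-reflexive (ℤₚ.*-zeroˡ (+ t)))))
  (ℤₚ.≤-reflexive (ℤₚ.+-identityʳ c)))) x5

Δ : (ℕ → ℤ) → ℕ → ℕ → ℕ → ℕ → ℤ
Δ f h i j k = f h ℤ.+ f i ℤ.- f j ℤ.- f k

-- Soundness of the automaton for the fixed point

module Sound (q q₀ σ t : ℕ) (q≡ : q ≡ q₀ + σ * t) where

  open FixedPoint q
  open Automaton q₀ σ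

  ⟦P⟧ : ⟦ P ⟧ t ≡ + p
  ⟦P⟧ = trans (cong (ℤ._+_ (+ (2 + q₀))) (sym (ℤₚ.pos-* σ t))) (cong (λ x → + (2 + x)) (sym q≡))

  ⟦P-n⟧ : ∀ {n m} → p ≡ m + n → ⟦ P ⊟ const (+ n) ⟧ t ≡ + m
  ⟦P-n⟧ {n} {m} p≡ = begin
    ⟦ P ⊟ const (+ n) ⟧ t          ≡⟨ ⟦⊟⟧ P (const (+ n)) t ⟩
    ⟦ P ⟧ t ℤ.- ⟦ const (+ n) ⟧ t  ≡⟨ cong₂ ℤ._-_ ⟦P⟧ (⟦const⟧ (+ n) t) ⟩
    + p ℤ.- + n                    ≡⟨ cong (λ x → + x ℤ.- + n) p≡ ⟩
    + m ℤ.+ + n ℤ.- + n            ≡⟨ cancel (+ m) (+ n) ⟩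
    + m                            ∎
    where
    open ≡-Reasoning
    cancel : ∀ m n → m ℤ.+ n ℤ.- n ≡ m
    cancel = ℤ-Solver.solve-∀

  Bounds : ℤ → Form → Form → Set
  Bounds x lo hi = ⟦ lo ⟧ t ℤ.≤ x × x ℤ.≤ ⟦ hi ⟧ t

  exactly : ∀ {x} f → ⟦ f ⟧ t ≡ x → Bounds x f f
  exactly f eq = ℤₚ.≤-reflexive eq , ℤₚ.≤-reflexive (sym eq)

  upTo′ : ∀ {r n} f → ⟦ f ⟧ t ≡ + n → r ≤ n → Bounds (+ r) (const 0ℤ) f
  upTo′ f eq r≤n = ℤ.+≤+ z≤n , ℤₚ.≤-trans (ℤ.+≤+ r≤n) (ℤₚ.≤-reflexive (sym eq))

  ∈-digits : ∀ {a r b} → Digit a r b → ∃₂ λ lo hi → (b , lo , hi) ∈ digits a × Bounds (+ r) lo hi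
  ∈-digits (LL r≤) = _ , _ , here refl , upTo′ (P ⊟ const 1ℤ) (⟦P-n⟧ (+-comm 1 (suc q))) r≤
  ∈-digits LS      = _ , _ , there (here refl) , exactly P ⟦P⟧
  ∈-digits (ML r≤) = _ , _ , here refl , upTo′ (P ⊟ const (+ 2)) (⟦P-n⟧ (+-comm 2 q)) r≤
  ∈-digits MS      = _ , _ , there (here refl) , exactly (P ⊟ const 1ℤ) (⟦P-n⟧ (+-comm 1 (suc q)))
  ∈-digits SM      = _ , _ , here refl , exactly (const 0ℤ) (⟦const⟧ 0ℤ t)

  Bounds-+ : ∀ {x y lo hi lo′ hi′} → Bounds x lo hi → Bounds y lo′ hi′ → Bounds (x ℤ.+ y) (lo ⊞ lo′) (hi ⊞ hi′)
  Bounds-+ {lo = lo} {hi} {lo′} {hi′} (l , h) (l′ , h′) =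
    ℤₚ.≤-trans (ℤₚ.≤-reflexive (⟦⊞⟧ lo lo′ t)) (ℤₚ.+-mono-≤ l l′) ,
    ℤₚ.≤-trans (ℤₚ.+-mono-≤ h h′) (ℤₚ.≤-reflexive (sym (⟦⊞⟧ hi hi′ t)))

  Bounds-- : ∀ {x y lo hi lo′ hi′} → Bounds x lo hi → Bounds y lo′ hi′ → Bounds (x ℤ.- y) (lo ⊟ hi′) (hi ⊟ lo′)
  Bounds-- {lo = lo} {hi} {lo′} {hi′} (l , h) (l′ , h′) =
    ℤₚ.≤-trans (ℤₚ.≤-reflexive (⟦⊟⟧ lo hi′ t)) (i-k≤j-l l h′) ,
    ℤₚ.≤-trans (i-k≤j-l h l′) (ℤₚ.≤-reflexive (sym (⟦⊟⟧ hi lo′ t)))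

  ∈-digits₂′ : ∀ {A a a′ r r′ b b′} → rep A ≡ (a , a′) → Digit a r b → Digit a′ r′ b′ →
               ∃₂ λ lo hi → (pair b b′ , lo , hi) ∈ digits₂ A × Bounds (+ r ℤ.+ + r′) lo hi
  ∈-digits₂′ {A} rep≡ d d′ with rep A | rep≡
  ... | _ | refl with ∈-digits d | ∈-digits d′
  ...   | lo , hi , ∈₁ , bounds | lo′ , hi′ , ∈₂ , bounds′ =
    lo ⊞ lo′ , hi ⊞ hi′ , ∈-concatMap ∈₁ (∈-map⁺ _ ∈₂) , Bounds-+ {lo = lo} {hi} {lo′} {hi′} bounds bounds′

  -- Forgetting the order of a pair is harmless, since only the sum of the two digits enters the
  -- length difference.
  ∈-digits₂ : ∀ {a a′ r r′ b b′} → Digit a r b → Digit a′ r′ b′ →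
              ∃₂ λ lo hi → (pair b b′ , lo , hi) ∈ digits₂ (pair a a′) × Bounds (+ r ℤ.+ + r′) lo hi
  ∈-digits₂ {a} {a′} {r} {r′} {b} {b′} d d′ with rep-pair a a′
  ... | inj₁ eq = ∈-digits₂′ eq d d′
  ... | inj₂ eq with ∈-digits₂′ eq d′ d
  ...   | lo , hi , ∈d , bounds = lo , hi ,
    subst (λ B → (B , lo , hi) ∈ digits₂ (pair a a′)) (pair-comm b′ b) ∈d ,
    subst (λ x → Bounds x lo hi) (ℤₚ.+-comm (+ r′) (+ r)) bounds

  #S #M #pos : ℕ → ℤ
  #S i = + proj₁ (proj₂ (ψ i))
  #M i = + proj₂ (proj₂ (ψ i))
  #pos k = + pos k

  stateOf : ℕ → ℕ → ℕ → ℕ → State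
  stateOf h i j k = state (Δ #S h i j k) (Δ #M h i j k) (Δ +_ h i j k) (pair (v h) (v i)) (pair (v j) (v k))

  -- One S arises from each letter other than S, and the letters L of an incomplete block add none.
  #S-child : ∀ k {r b} → Digit (v k) r b → #S (pos k + r) ≡ + k ℤ.- #S k
  #S-child k d = trans (cong (λ x → + proj₁ (proj₂ x)) (ψ-digit k d))
    (trans (lem (+ l) (+ s) (+ m)) (cong (λ x → + x ℤ.- + s) (∣ψ∣ k)))
    where
    l = proj₁ (ψ k)
    s = proj₁ (proj₂ (ψ k))
    m = proj₂ (proj₂ (ψ k))
    lem : ∀ l s m → l ℤ.+ m ≡ l ℤ.+ s ℤ.+ m ℤ.- s
    lem = ℤ-Solver.solve-∀

  #M-child : ∀ k {r b} → Digit (v k) r b → #M (pos k + r) ≡ #S k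
  #M-child k d = cong (λ x → + proj₂ (proj₂ x)) (ψ-digit k d)

  #pos≡ : ∀ k → #pos k ≡ (+ k ℤ.- #S k) ℤ.* + p ℤ.+ (+ k ℤ.- #M k)
  #pos≡ k = begin
    + pos k                                        ≡⟨ cong +_ (∣ψ∣ (pos k)) ⟨
    + ∣ ψ (pos k) ∣ₚ                               ≡⟨ cong (λ x → + ∣ x ∣ₚ) (ψ-pos k) ⟩
    + ∣ image (ψ k) 0 ∣ₚ                           ≡⟨ cong +_ (lemℕ q l s m) ⟩
    + (p * (l + m) + (l + s))              ≡⟨ cong (ℤ._+ + (l + s)) (ℤₚ.pos-* p (l + m)) ⟩
    + p ℤ.* (+ l ℤ.+ + m) ℤ.+ (+ l ℤ.+ + s)        ≡⟨ lem (+ p) (+ l) (+ s) (+ m) ⟩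
    (+ ∣ ψ k ∣ₚ ℤ.- #S k) ℤ.* + p ℤ.+ (+ ∣ ψ k ∣ₚ ℤ.- #M k)  ≡⟨ cong (λ x → (+ x ℤ.- #S k) ℤ.* + p ℤ.+ (+ x ℤ.- #M k)) (∣ψ∣ k) ⟩
    (+ k ℤ.- #S k) ℤ.* + p ℤ.+ (+ k ℤ.- #M k)      ∎
    where
    open ≡-Reasoning
    l = proj₁ (ψ k)
    s = proj₁ (proj₂ (ψ k))
    m = proj₂ (proj₂ (ψ k))
    lemℕ : ∀ q l s m → (2 + q) * l + suc q * m + 0 + (l + m) + s ≡ (2 + q) * (l + m) + (l + s)
    lemℕ = ℕ-Solver.solve-∀
    lem : ∀ p l s m → p ℤ.* (l ℤ.+ m) ℤ.+ (l ℤ.+ s) ≡ (l ℤ.+ s ℤ.+ m ℤ.- s) ℤ.* p ℤ.+ (l ℤ.+ s ℤ.+ m ℤ.- m)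
    lem = ℤ-Solver.solve-∀

  Δ-cong : ∀ (f g : ℕ → ℤ) {h i j k h′ i′ j′ k′} → f h′ ≡ g h → f i′ ≡ g i → f j′ ≡ g j → f k′ ≡ g k →
           Δ f h′ i′ j′ k′ ≡ Δ g h i j k
  Δ-cong f g eh ei ej ek = cong₂ ℤ._-_ (cong₂ ℤ._-_ (cong₂ ℤ._+_ eh ei) ej) ek

  Δ-- : ∀ f g h i j k → Δ (λ x → f x ℤ.- g x) h i j k ≡ Δ f h i j k ℤ.- Δ g h i j k
  Δ-- f g h i j k = lem (f h) (f i) (f j) (f k) (g h) (g i) (g j) (g k)
    where
    lem : ∀ a b c d a′ b′ c′ d′ → a ℤ.- a′ ℤ.+ (b ℤ.- b′) ℤ.- (c ℤ.- c′) ℤ.- (d ℤ.- d′) ≡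
                                  a ℤ.+ b ℤ.- c ℤ.- d ℤ.- (a′ ℤ.+ b′ ℤ.- c′ ℤ.- d′)
    lem = ℤ-Solver.solve-∀

  ⟦base⟧ : ∀ h i j k → ⟦ base (stateOf h i j k) ⟧ t ≡ Δ #pos h i j k
  ⟦base⟧ h i j k = begin
    ⟦ (x ℤ.- s) ⊠ P ⊞ const (x ℤ.- m) ⟧ t             ≡⟨ ⟦⊞⟧ ((x ℤ.- s) ⊠ P) (const (x ℤ.- m)) t ⟩
    ⟦ (x ℤ.- s) ⊠ P ⟧ t ℤ.+ ⟦ const (x ℤ.- m) ⟧ t     ≡⟨ cong₂ ℤ._+_ (trans (⟦⊠⟧ (x ℤ.- s) P t) (cong (ℤ._*_ (x ℤ.- s)) ⟦P⟧)) (⟦const⟧ (x ℤ.- m) t) ⟩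
    (x ℤ.- s) ℤ.* + p ℤ.+ (x ℤ.- m)                   ≡⟨ cong₂ (λ y z → y ℤ.* + p ℤ.+ z) (Δ-- +_ #S h i j k) (Δ-- +_ #M h i j k) ⟨
    Δ (λ y → + y ℤ.- #S y) h i j k ℤ.* + p ℤ.+ Δ (λ y → + y ℤ.- #M y) h i j k
      ≡⟨ lem (+ h ℤ.- #S h) (+ i ℤ.- #S i) (+ j ℤ.- #S j) (+ k ℤ.- #S k)
             (+ h ℤ.- #M h) (+ i ℤ.- #M i) (+ j ℤ.- #M j) (+ k ℤ.- #M k) (+ p) ⟩
    Δ (λ y → (+ y ℤ.- #S y) ℤ.* + p ℤ.+ (+ y ℤ.- #M y)) h i j k
      ≡⟨ Δ-cong #pos (λ y → (+ y ℤ.- #S y) ℤ.* + p ℤ.+ (+ y ℤ.- #M y)) {h} {i} {j} {k} {h} {i} {j} {k}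
           (#pos≡ h) (#pos≡ i) (#pos≡ j) (#pos≡ k) ⟨
    Δ #pos h i j k                                    ∎
    where
    open ≡-Reasoning
    x = Δ +_ h i j k
    s = Δ #S h i j k
    m = Δ #M h i j k
    lem : ∀ a b c d a′ b′ c′ d′ p → (a ℤ.+ b ℤ.- c ℤ.- d) ℤ.* p ℤ.+ (a′ ℤ.+ b′ ℤ.- c′ ℤ.- d′) ≡
          (a ℤ.* p ℤ.+ a′) ℤ.+ (b ℤ.* p ℤ.+ b′) ℤ.- (c ℤ.* p ℤ.+ c′) ℤ.- (d ℤ.* p ℤ.+ d′)
    lem = ℤ-Solver.solve-∀

  -- Exchanging the two pairs swaps the components, so a one-sided argument covers both.
  Near : ℕ → ℕ → ℕ → ℕ → Set
  Near h i j k = h + i ≤ 5 + (j + k) × j + k ≤ 5 + (h + i)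

  -- Completeness of the transitions: the actual digits lie between the affine bounds evaluated at
  -- `t`, and nearness of the descendants ensures that the cut-off at ±5 removes nothing relevant.
  ∈-children : ∀ {h i j k rₕ rᵢ rⱼ rₖ a b c d} →
    Digit (v h) rₕ a → Digit (v i) rᵢ b → Digit (v j) rⱼ c → Digit (v k) rₖ d →
    Near (pos h + rₕ) (pos i + rᵢ) (pos j + rⱼ) (pos k + rₖ) →
    stateOf (pos h + rₕ) (pos i + rᵢ) (pos j + rⱼ) (pos k + rₖ) ∈ children (stateOf h i j k)
  ∈-children {h} {i} {j} {k} {rₕ} {rᵢ} {rⱼ} {rₖ} {a} {b} {c} {d} dₕ dᵢ dⱼ dₖ (near₁ , near₂)
    with lo , hi , ∈₁ , bounds ← ∈-digits₂ dₕ dᵢ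
    with lo′ , hi′ , ∈₂ , bounds′ ← ∈-digits₂ dⱼ dₖ =
    subst (_∈ children st) (sym st′≡)
      (∈-concatMap ∈₁ (∈-concatMap ∈₂ (∈-map⁺ _ (∈-between
        (lower≤ (base st ⊞ lo ⊟ hi′) {t} (proj₁ inside) -5≤x′) (≤upper (base st ⊞ hi ⊟ lo′) {t} (proj₂ inside) x′≤5)))))
    where
    st = stateOf h i j k
    x′ = Δ +_ (pos h + rₕ) (pos i + rᵢ) (pos j + rⱼ) (pos k + rₖ)
    st′ = state (Δ +_ h i j k ℤ.- Δ #S h i j k) (Δ #S h i j k) x′ (pair a b) (pair c d)
    st′≡ : stateOf (pos h + rₕ) (pos i + rᵢ) (pos j + rⱼ) (pos k + rₖ) ≡ st′
    st′≡ rewrite v-digit h dₕ | v-digit i dᵢ | v-digit j dⱼ | v-digit k dₖ =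
      cong₂ (λ s m → state s m x′ (pair a b) (pair c d))
        (trans (Δ-cong #S (λ y → + y ℤ.- #S y) {h} {i} {j} {k} {pos h + rₕ} {pos i + rᵢ} {pos j + rⱼ} {pos k + rₖ}
          (#S-child h dₕ) (#S-child i dᵢ) (#S-child j dⱼ) (#S-child k dₖ))
               (Δ-- +_ #S h i j k))
        (Δ-cong #M #S {h} {i} {j} {k} {pos h + rₕ} {pos i + rᵢ} {pos j + rⱼ} {pos k + rₖ}
          (#M-child h dₕ) (#M-child i dᵢ) (#M-child j dⱼ) (#M-child k dₖ))
    x′≡ : x′ ≡ Δ #pos h i j k ℤ.+ (+ rₕ ℤ.+ + rᵢ) ℤ.- (+ rⱼ ℤ.+ + rₖ)
    x′≡ = lem (#pos h) (#pos i) (#pos j) (#pos k) (+ rₕ) (+ rᵢ) (+ rⱼ) (+ rₖ)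
      where
      lem : ∀ a b c d a′ b′ c′ d′ → a ℤ.+ a′ ℤ.+ (b ℤ.+ b′) ℤ.- (c ℤ.+ c′) ℤ.- (d ℤ.+ d′) ≡
                                    a ℤ.+ b ℤ.- c ℤ.- d ℤ.+ (a′ ℤ.+ b′) ℤ.- (c′ ℤ.+ d′)
      lem = ℤ-Solver.solve-∀
    inside : Bounds x′ (base st ⊞ lo ⊟ hi′) (base st ⊞ hi ⊟ lo′)
    inside = subst (λ y → Bounds y (base st ⊞ lo ⊟ hi′) (base st ⊞ hi ⊟ lo′)) (sym x′≡)
      (Bounds-- {lo = base st ⊞ lo} {base st ⊞ hi} {lo′} {hi′}
        (Bounds-+ {lo = base st} {base st} {lo} {hi} (exactly (base st) (⟦base⟧ h i j k)) bounds) bounds′)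
    sub : ∀ a b c d {n : ℕ} → a + b ≤ n + (c + d) → + a ℤ.+ + b ℤ.- + c ℤ.- + d ℤ.≤ + n
    sub a b c d {n} le = subst₂ ℤ._≤_ (lem₁ (+ a) (+ b) (+ c) (+ d)) (lem₂ (+ n) (+ c) (+ d)) (ℤₚ.+-monoˡ-≤ (ℤ.- (+ c ℤ.+ + d)) (ℤ.+≤+ le))
      where
      lem₁ : ∀ a b c d → a ℤ.+ b ℤ.+ ℤ.- (c ℤ.+ d) ≡ a ℤ.+ b ℤ.- c ℤ.- d
      lem₁ = ℤ-Solver.solve-∀
      lem₂ : ∀ n c d → n ℤ.+ (c ℤ.+ d) ℤ.+ ℤ.- (c ℤ.+ d) ≡ n
      lem₂ = ℤ-Solver.solve-∀
    x′≤5 : x′ ℤ.≤ + 5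
    x′≤5 = sub (pos h + rₕ) (pos i + rᵢ) (pos j + rⱼ) (pos k + rₖ) near₁
    -5≤x′ : -[1+ 4 ] ℤ.≤ x′
    -5≤x′ = ℤₚ.neg-cancel-≤ (subst (ℤ._≤ + 5) (lem (+ (pos h + rₕ)) (+ (pos i + rᵢ)) (+ (pos j + rⱼ)) (+ (pos k + rₖ)))
      (sub (pos j + rⱼ) (pos k + rₖ) (pos h + rₕ) (pos i + rᵢ) near₂))
      where
      lem : ∀ a b c d → c ℤ.+ d ℤ.- a ℤ.- b ≡ ℤ.- (a ℤ.+ b ℤ.- c ℤ.- d)
      lem = ℤ-Solver.solve-∀

  topℕ : Letter → ℕ
  topℕ L = p
  topℕ S = 0
  topℕ M = suc q

  digit≤top : ∀ {a r b} → Digit a r b → r ≤ topℕ a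
  digit≤top (LL r≤) = m≤n⇒m≤1+n r≤
  digit≤top LS      = ≤-refl
  digit≤top (ML r≤) = m≤n⇒m≤1+n r≤
  digit≤top MS      = ≤-refl
  digit≤top SM      = ≤-refl

  ⟦top⟧ : ∀ a → ⟦ top a ⟧ t ≡ + topℕ a
  ⟦top⟧ L = ⟦P⟧
  ⟦top⟧ S = ⟦const⟧ 0ℤ t
  ⟦top⟧ M = ⟦P-n⟧ (+-comm 1 (suc q))

  ⟦tops⟧ : ∀ f a b → ⟦ f ⊟ top (proj₁ (rep (pair a b))) ⊟ top (proj₂ (rep (pair a b))) ⟧ t ≡
                     ⟦ f ⟧ t ℤ.- + (topℕ a + topℕ b)
  ⟦tops⟧ f a b = trans (lem a′ b′) (cong (λ x → ⟦ f ⟧ t ℤ.- + x) tops≡)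
    where
    a′ = proj₁ (rep (pair a b))
    b′ = proj₂ (rep (pair a b))
    tops≡ : topℕ a′ + topℕ b′ ≡ topℕ a + topℕ b
    tops≡ with rep (pair a b) | rep-pair a b
    ... | _ | inj₁ refl = refl
    ... | _ | inj₂ refl = +-comm (topℕ b) (topℕ a)
    lem : ∀ a b → ⟦ f ⊟ top a ⊟ top b ⟧ t ≡ ⟦ f ⟧ t ℤ.- + (topℕ a + topℕ b)
    lem a b = begin
      ⟦ f ⊟ top a ⊟ top b ⟧ t                   ≡⟨ ⟦⊟⟧ (f ⊟ top a) (top b) t ⟩
      ⟦ f ⊟ top a ⟧ t ℤ.- ⟦ top b ⟧ t           ≡⟨ cong₂ ℤ._-_ (⟦⊟⟧ f (top a) t) (⟦top⟧ b) ⟩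
      ⟦ f ⟧ t ℤ.- ⟦ top a ⟧ t ℤ.- + topℕ b      ≡⟨ cong (λ x → ⟦ f ⟧ t ℤ.- x ℤ.- + topℕ b) (⟦top⟧ a) ⟩
      ⟦ f ⟧ t ℤ.- + topℕ a ℤ.- + topℕ b         ≡⟨ assoc (⟦ f ⟧ t) (+ topℕ a) (+ topℕ b) ⟩
      ⟦ f ⟧ t ℤ.- (+ topℕ a ℤ.+ + topℕ b)       ∎
      where
      open ≡-Reasoning
      assoc : ∀ x y z → x ℤ.- y ℤ.- z ≡ x ℤ.- (y ℤ.+ z)
      assoc = ℤ-Solver.solve-∀

  above≤ : ∀ f {n} → T ((+ n ℤ.≤ᵇ proj₁ f) ∧ (0ℤ ℤ.≤ᵇ proj₂ f)) → + n ℤ.≤ ⟦ f ⟧ t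
  above≤ (c , + d) {n} ok = ℤₚ.≤-trans (ℤₚ.≤ᵇ⇒≤ (proj₁ (T-∧⁻ {+ n ℤ.≤ᵇ c} ok)))
    (ℤₚ.≤-trans (ℤₚ.i≤i+j c (+ (d * t))) (ℤₚ.≤-reflexive (cong (ℤ._+_ c) (ℤₚ.pos-* d t))))
  above≤ (c , -[1+ d ]) {n} ok with () ← proj₂ (T-∧⁻ {+ n ℤ.≤ᵇ c} ok)

  pos-mono : ∀ k → pos k < pos (suc k)
  pos-mono k = ≤-trans (≤-reflexive (+-comm 1 (pos k))) (+-monoʳ-≤ (pos k) (1≤size (v k)))

  k<pos : ∀ k → suc k < pos (suc k)
  k<pos zero    = s≤s (s≤s z≤n)
  k<pos (suc k) = ≤-<-trans (k<pos k) (pos-mono (suc k))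

  open Parent using () renaming (k to ancestor)

  parent< : ∀ {i} (P : Parent (suc i)) → ancestor P < suc i
  parent< (parent zero    r _ eq) = s≤s z≤n
  parent< (parent (suc k) r _ eq) = <-≤-trans (k<pos k) (≤-trans (m≤m+n (pos (suc k)) r) (≤-reflexive eq))

  parent≤ : ∀ {i} (P : Parent i) → ancestor P ≤ i
  parent≤ {suc i} P                     = <⇒≤ (parent< P)
  parent≤ {zero}  (parent zero    _ _ _) = z≤n
  parent≤ {zero}  (parent (suc k) r _ eq) with () ← ≤-trans (≤-trans (s≤s z≤n) (<⇒≤ (k<pos k))) (≤-trans (m≤m+n (pos (suc k)) r) (≤-reflexive eq))

  module Invariant (certificate : Certificate) where

    open Certificate certificate

    ok : T (valid trie)
    ok = subst T (sym valid≡) _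

    Inv : ℕ → ℕ → ℕ → ℕ → Set
    Inv h i j k = Near h i j k → T (contains trie (stateOf h i j k))

    Below : ℕ → Set
    Below N = ∀ h i j k → h + i + (j + k) < N → Inv h i j k

    goods : ∀ st → T (contains trie st) → T (good trie st)
    goods st = contains-everywhere trie st (proj₂ (T-∧⁻ {contains trie root} ok))

    exit : ∀ h i j k → T (contains trie (stateOf h i j k)) → h + i ≡ 5 + (j + k) →
           pos j + pos k + (topℕ (v j) + topℕ (v k)) + 5 ≤ pos h + pos i
    exit h i j k st∈ sum≡
      with Equivalence.to (T-∨ {Δ +_ h i j k ℤ.≤ᵇ + 4})
             (proj₁ (T-∧⁻ {exits st} (proj₂ (T-∧⁻ {all (contains trie) (children st)} (goods st st∈)))))
      where st = stateOf h i j k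
    ... | inj₁ small = contradiction (ℤₚ.≤ᵇ⇒≤ {+ 5} {+ 4} (subst (λ x → T (x ℤ.≤ᵇ + 4)) Δ≡5 small)) λ { (ℤ.+≤+ (s≤s (s≤s (s≤s (s≤s ()))))) }
      where
      lem : ∀ j k n → n ℤ.+ (j ℤ.+ k) ℤ.- j ℤ.- k ≡ n
      lem = ℤ-Solver.solve-∀
      Δ≡5 : Δ +_ h i j k ≡ + 5
      Δ≡5 = trans (cong (λ x → + x ℤ.- + j ℤ.- + k) sum≡) (lem (+ j) (+ k) (+ 5))
    ... | inj₂ large = ℤₚ.drop‿+≤+ (ℤₚ.0≤i-j⇒j≤i (subst (0ℤ ℤ.≤_) (lem (#pos h) (#pos i) (#pos j) (#pos k) (+ (topℕ (v j) + topℕ (v k))) (+ 5))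
        (ℤₚ.i≤j⇒0≤j-i (subst (+ 5 ℤ.≤_) (trans (⟦tops⟧ (base st) (v j) (v k)) (cong (ℤ._- + (topℕ (v j) + topℕ (v k))) (⟦base⟧ h i j k)))
          (above≤ (base st ⊟ top (proj₁ (rep (pair (v j) (v k)))) ⊟ top (proj₂ (rep (pair (v j) (v k))))) large)))))
      where
      st = stateOf h i j k
      lem : ∀ a b c d x y → a ℤ.+ b ℤ.- c ℤ.- d ℤ.- x ℤ.- y ≡ a ℤ.+ b ℤ.- (c ℤ.+ d ℤ.+ x ℤ.+ y)
      lem = ℤ-Solver.solve-∀

    -- Once the length difference exceeds 5 it stays above 5 in the images: lower h or i one step at a time until
    -- the difference is 5, where exit applies.
    far : ∀ {N} → Below N → ∀ e h i j k → h + i + (j + k) < N → h + i ≡ e + (5 + (j + k)) →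
          e + (pos j + pos k + (topℕ (v j) + topℕ (v k)) + 5) ≤ pos h + pos i
    far below zero h i j k <N sum≡ = exit h i j k
      (below h i j k <N (≤-reflexive sum≡ , ≤-trans (m≤n+m _ 10) (≤-reflexive (cong (_+_ 5) (sym sum≡))))) sum≡
    far below (suc e) (suc h) i j k <N sum≡ = ≤-trans
      (s≤s (far below e h i j k (<-trans (n<1+n _) <N) (suc-injective sum≡)))
      (+-monoˡ-≤ (pos i) (pos-mono h))
    far below (suc e) zero (suc i) j k <N sum≡ = ≤-trans
      (s≤s (far below e zero i j k (<-trans (n<1+n _) <N) (suc-injective sum≡)))
      (pos-mono i)

    -- By contraposition: if the ancestors differ by more than 5, `far` keeps the descendants more
    -- than 5 apart even with digits 0 on the longer side and the largest digits on the shorter one.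
    close : ∀ {N} → Below N → ∀ {h i j k rₕ rᵢ rⱼ rₖ} → h + i + (j + k) < N →
            rⱼ ≤ topℕ (v j) → rₖ ≤ topℕ (v k) →
            pos h + rₕ + (pos i + rᵢ) ≤ 5 + (pos j + rⱼ + (pos k + rₖ)) →
            h + i ≤ 5 + (j + k)
    close below {h} {i} {j} {k} {rₕ} {rᵢ} {rⱼ} {rₖ} <N rⱼ≤ rₖ≤ near with ≤-<-connex (h + i) (5 + (j + k))
    ... | inj₁ ≤5 = ≤5
    ... | inj₂ >5 = contradiction too-close (<⇒≱ (n<1+n _))
      where
      -- The excess over a difference of 6. Applying `far` at `suc e` gains at least one over the
      -- bound that `near` permits.
      e = h + i ∸ suc (5 + (j + k))
      tops = pos j + pos k + (topℕ (v j) + topℕ (v k)) + 5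
      sum≡ : h + i ≡ suc e + (5 + (j + k))
      sum≡ = trans (sym (m∸n+n≡m >5)) (+-suc e (5 + (j + k)))
      lem : ∀ a b c d → 5 + (a + c + (b + d)) ≡ a + b + (c + d) + 5
      lem = ℕ-Solver.solve-∀
      open ≤-Reasoning
      too-close : suc tops ≤ tops
      too-close = begin
        suc tops                                            ≤⟨ s≤s (m≤n+m tops e) ⟩
        suc e + tops                                      ≤⟨ far below (suc e) h i j k <N sum≡ ⟩
        pos h + pos i                                     ≤⟨ +-mono-≤ (m≤m+n (pos h) rₕ) (m≤m+n (pos i) rᵢ) ⟩
        pos h + rₕ + (pos i + rᵢ)                     ≤⟨ near ⟩
        5 + (pos j + rⱼ + (pos k + rₖ))             ≤⟨ +-monoʳ-≤ 5 (+-mono-≤ (+-monoʳ-≤ (pos j) rⱼ≤) (+-monoʳ-≤ (pos k) rₖ≤)) ⟩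
        5 + (pos j + topℕ (v j) + (pos k + topℕ (v k))) ≡⟨ lem (pos j) (pos k) _ _ ⟩
        tops                                                ∎

    -- Nearness passes up to the parents by `close`, used once for each order of the pairs. The
    -- parents' state is then in the trie, and the trie is closed under `children`.
    step : ∀ {N h i j k} → Below N → (A : Parent h) (B : Parent i) (C : Parent j) (D : Parent k) →
           ancestor A + ancestor B + (ancestor C + ancestor D) < N → Inv h i j k
    step {N} below (parent h rₕ dₕ refl) (parent i rᵢ dᵢ refl) (parent j rⱼ dⱼ refl) (parent k rₖ dₖ refl) <N near =
      All.lookup (all⁺ (contains trie) (children st) (proj₁ (T-∧⁻ {all (contains trie) (children st)} (goods st st∈))))
                 (∈-children {h} {i} {j} {k} dₕ dᵢ dⱼ dₖ near)
      where
      st = stateOf h i j k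
      st∈ : T (contains trie st)
      st∈ = below h i j k <N
        ( close below {h} {i} {j} {k} <N (digit≤top dⱼ) (digit≤top dₖ) (proj₁ near)
        , close below {j} {k} {h} {i} (subst (_< N) (+-comm (h + i) (j + k)) <N) (digit≤top dₕ) (digit≤top dᵢ) (proj₂ near))

    -- Induction on the sum of the four positions: a positive position has a strictly smaller parent
    -- and 0 is its own parent, so only four zeros, the root, remain as base case.
    invariant : ∀ N → Below N
    invariant (suc N) zero    zero    zero    zero    _ _ = proj₁ (T-∧⁻ {contains trie root} ok)
    invariant (suc N) (suc h) i       j       k       (s≤s <N) = step (invariant N) (parentOf (suc h)) (parentOf i) (parentOf j) (parentOf k)
      (<-≤-trans (+-mono-<-≤ (+-mono-<-≤ (parent< (parentOf (suc h))) (parent≤ (parentOf i))) (+-mono-≤ (parent≤ (parentOf j)) (parent≤ (parentOf k)))) <N)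
    invariant (suc N) zero    (suc i) j       k       (s≤s <N) = step (invariant N) (parentOf zero) (parentOf (suc i)) (parentOf j) (parentOf k)
      (<-≤-trans (+-mono-<-≤ (+-mono-≤-< (parent≤ (parentOf zero)) (parent< (parentOf (suc i)))) (+-mono-≤ (parent≤ (parentOf j)) (parent≤ (parentOf k)))) <N)
    invariant (suc N) zero    zero    (suc j) k       (s≤s <N) = step (invariant N) (parentOf zero) (parentOf zero) (parentOf (suc j)) (parentOf k)
      (<-≤-trans (+-mono-≤-< (+-mono-≤ (parent≤ (parentOf zero)) (parent≤ (parentOf zero))) (+-mono-<-≤ (parent< (parentOf (suc j))) (parent≤ (parentOf k)))) <N)
    invariant (suc N) zero    zero    zero    (suc k) (s≤s <N) = step (invariant N) (parentOf zero) (parentOf zero) (parentOf zero) (parentOf (suc k))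
      (<-≤-trans (+-mono-≤-< (+-mono-≤ (parent≤ (parentOf zero)) (parent≤ (parentOf zero))) (+-mono-≤-< (parent≤ (parentOf zero)) (parent< (parentOf (suc k))))) <N)

    %7-difference : ∀ x y → x % 7 ≡ y % 7 → ∣ + x ℤ.- + y ∣ % 7 ≡ 0
    %7-difference x y eq = begin
      ∣ + x ℤ.- + y ∣ % 7                          ≡⟨ cong (λ z → ∣ z ∣ % 7) difference ⟩
      ∣ (+ (x / 7) ℤ.- + (y / 7)) ℤ.* + 7 ∣ % 7    ≡⟨ cong (_% 7) (ℤₚ.abs-* (+ (x / 7) ℤ.- + (y / 7)) (+ 7)) ⟩
      ∣ + (x / 7) ℤ.- + (y / 7) ∣ * 7 % 7        ≡⟨ m*n%n≡0 ∣ + (x / 7) ℤ.- + (y / 7) ∣ 7 ⟩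
      0                                            ∎
      where
      open ≡-Reasoning
      split : ∀ x → + x ≡ + (x % 7) ℤ.+ + (x / 7) ℤ.* + 7
      split x = trans (cong +_ (m≡m%n+[m/n]*n x 7)) (cong (ℤ._+_ (+ (x % 7))) (ℤₚ.pos-* (x / 7) 7))
      lem : ∀ r a b → r ℤ.+ a ℤ.* + 7 ℤ.- (r ℤ.+ b ℤ.* + 7) ≡ (a ℤ.- b) ℤ.* + 7
      lem = ℤ-Solver.solve-∀
      difference : + x ℤ.- + y ≡ (+ (x / 7) ℤ.- + (y / 7)) ℤ.* + 7
      difference = trans (cong₂ ℤ._-_ (split x) (trans (split y) (cong (λ r → + r ℤ.+ + (y / 7) ℤ.* + 7) (sym eq))))
        (lem (+ (x % 7)) (+ (x / 7)) (+ (y / 7)))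

    separates : Separated v
    separates n i j eq = cong₂ _,_ l≡ (cong₂ _,_ s≡ m≡)
      where
      fᵢ = factorΨ v i n
      fⱼ = factorΨ v j n
      s m s′ m′ : ℕ
      s = proj₁ (proj₂ fᵢ)
      m = proj₂ (proj₂ fᵢ)
      s′ = proj₁ (proj₂ fⱼ)
      m′ = proj₂ (proj₂ fⱼ)
      -- Ψ(u[i,i+n)) - Ψ(u[j,j+n)) equals ψ(i+n) + ψ(j) - ψ(i) - ψ(j+n), a balanced combination of
      -- four prefixes.
      st = stateOf (i + n) j i (j + n)
      cancel : ∀ a x b y → a ℤ.+ x ℤ.+ b ℤ.- a ℤ.- (b ℤ.+ y) ≡ x ℤ.- y
      cancel = ℤ-Solver.solve-∀
      balanced : i + n + j ≡ i + (j + n)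
      balanced = trans (+-assoc i n j) (cong (_+_ i) (+-comm n j))
      st∈ : T (contains trie st)
      st∈ = invariant _ (i + n) j i (j + n) ≤-refl
        ( ≤-trans (≤-reflexive balanced) (m≤n+m _ 5)
        , ≤-trans (≤-reflexive (sym balanced)) (m≤n+m _ 5))
      #S-difference : Δ #S (i + n) j i (j + n) ≡ + s ℤ.- + s′
      #S-difference = trans (cong₂ (λ x y → + proj₁ (proj₂ x) ℤ.+ #S j ℤ.- #S i ℤ.- + proj₁ (proj₂ y)) (ψ-factor i n) (ψ-factor j n))
        (cancel (#S i) (+ s) (#S j) (+ s′))
      #M-difference : Δ #M (i + n) j i (j + n) ≡ + m ℤ.- + m′
      #M-difference = trans (cong₂ (λ x y → + proj₂ (proj₂ x) ℤ.+ #M j ℤ.- #M i ℤ.- + proj₂ (proj₂ y)) (ψ-factor i n) (ψ-factor j n))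
        (cancel (#M i) (+ m) (#M j) (+ m′))
      length-difference : Δ +_ (i + n) j i (j + n) ≡ 0ℤ
      length-difference = trans (cancel (+ i) (+ n) (+ j) (+ n)) (ℤₚ.+-inverseʳ (+ n))
      weight-difference : + 3 ℤ.* (+ s ℤ.- + s′) ℤ.+ (+ m ℤ.- + m′) ≡ + weight fᵢ ℤ.- + weight fⱼ
      weight-difference = trans (lem (+ s) (+ s′) (+ m) (+ m′))
        (cong₂ (λ x y → x ℤ.+ + m ℤ.- (y ℤ.+ + m′)) (sym (ℤₚ.pos-* 3 s)) (sym (ℤₚ.pos-* 3 s′)))
        where
        lem : ∀ s s′ m m′ → + 3 ℤ.* (s ℤ.- s′) ℤ.+ (m ℤ.- m′) ≡ + 3 ℤ.* s ℤ.+ m ℤ.- (+ 3 ℤ.* s′ ℤ.+ m′)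
        lem = ℤ-Solver.solve-∀
      same : T ((∣ + s ℤ.- + s′ ∣ ≡ᵇ 0) ∧ (∣ + m ℤ.- + m′ ∣ ≡ᵇ 0))
      same = T-⇒ {(∣ 0ℤ ∣ ≡ᵇ 0) ∧ (∣ + 3 ℤ.* (+ s ℤ.- + s′) ℤ.+ (+ m ℤ.- + m′) ∣ % 7 ≡ᵇ 0)}
        (subst T (cong₂ (λ x (y , z) → (∣ x ∣ ≡ᵇ 0) ∧ (∣ + 3 ℤ.* y ℤ.+ z ∣ % 7 ≡ᵇ 0) ⇒ (∣ y ∣ ≡ᵇ 0) ∧ (∣ z ∣ ≡ᵇ 0))
            length-difference (cong₂ _,_ #S-difference #M-difference))
          (proj₂ (T-∧⁻ {exits st} (proj₂ (T-∧⁻ {all (contains trie) (children st)} (goods st st∈))))))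
        (≡⇒≡ᵇ _ 0 (trans (cong (λ x → ∣ x ∣ % 7) weight-difference) (%7-difference (weight fᵢ) (weight fⱼ) eq)))
      s≡ : s ≡ s′
      s≡ = ℤₚ.+-injective (∣i-j∣≡0⇒i≡j (+ s) (+ s′) (proj₁ (T-∧⁻ {∣ + s ℤ.- + s′ ∣ ≡ᵇ 0} same)))
      m≡ : m ≡ m′
      m≡ = ℤₚ.+-injective (∣i-j∣≡0⇒i≡j (+ m) (+ m′) (proj₂ (T-∧⁻ {∣ + s ℤ.- + s′ ∣ ≡ᵇ 0} same)))
      l≡ : proj₁ fᵢ ≡ proj₁ fⱼ
      l≡ = +-cancelʳ-≡ s _ _ (+-cancelʳ-≡ m _ _ (trans (∣factorΨ∣ i n) (trans (sym (∣factorΨ∣ j n))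
        (cong₂ (λ x y → proj₁ fⱼ + x + y) (sym s≡) (sym m≡)))))

-- Seven Parikh vectors

-- Constructor names record the parent letter and the digit: Lp-2 is digit p - 2 of φ_p(L).
data Symbol : Letter → Letter → Set where
  L0 L1 Lp-2 Lp-1 : Symbol L L
  Lp              : Symbol L S
  Mp-2            : Symbol M L
  Mp-1            : Symbol M S
  S0              : Symbol S M

infixr 5 _∥_∷_
-- Digits of the left and the right end of a factor under successive applications of φ_p.
data Chain : Letter → Letter → Set where
  []    : ∀ {a b} → Chain a b
  _∥_∷_ : ∀ {a b a′ b′} → Symbol a a′ → Symbol b b′ → Chain a′ b′ → Chain a b

-- Generic in A in order to evaluate both in ℤ and in polynomials, to which the ring solver applies.
module Evaluation {A : Set} (_+_ _*_ _-_ : A → A → A) (fromℕ : ℕ → A) (Q : A) where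

  infixl 6 _+ᵥ_
  _+ᵥ_ : A × A × A → A × A × A → A × A × A
  (l , s , m) +ᵥ (l′ , s′ , m′) = (l + l′) , (s + s′) , (m + m′)

  value : ∀ {a b} → Symbol a b → A
  value L0   = fromℕ 0
  value L1   = fromℕ 1
  value Lp-2 = Q
  value Lp-1 = fromℕ 1 + Q
  value Lp   = fromℕ 2 + Q
  value Mp-2 = Q
  value Mp-1 = fromℕ 1 + Q
  value S0   = fromℕ 0

  -- The effect of φ_p on a factor whose left end moves to digit r inside its first block and whose
  -- right end moves to digit r′ of the block following it: r letters L are dropped and r′ are
  -- added.
  transfer : A × A × A → A → A → A × A × A
  transfer (l , s , m) r r′ = (((((fromℕ 2 + Q) * l) + ((fromℕ 1 + Q) * m)) + r′) - r) , (l + m) , s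

  run : ∀ {a b} → Chain a b → A × A × A → A × A × A
  run []          w = w
  run (x ∥ y ∷ c) w = run c (transfer w (value x) (value y))

  total : A × A × A → A
  total (l , s , m) = (l + s) + m

  weigh : A × A × A → A
  weigh (l , s , m) = (fromℕ 3 * s) + m

  unit : Letter → A × A × A
  unit L = fromℕ 1 , fromℕ 0 , fromℕ 0
  unit S = fromℕ 0 , fromℕ 1 , fromℕ 0
  unit M = fromℕ 0 , fromℕ 0 , fromℕ 1

-- Found by desubstituting seven factors of length p⁴ + 2p³ + 4p² + 2p with different Parikh vectors.
chains : Fin 7 → ∃ λ a → Chain a L
chains 0F = S , S0 ∥ L1 ∷ Mp-1 ∥ L0 ∷ S0 ∥ Lp-1 ∷ Mp-2 ∥ Lp-1 ∷ L0 ∥ Lp ∷ []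
chains 1F = S , S0 ∥ L1 ∷ Mp-1 ∥ L0 ∷ S0 ∥ Lp ∷ Mp-1 ∥ S0 ∷ S0 ∥ Mp-1 ∷ []
chains 2F = M , Mp-2 ∥ L0 ∷ Lp-2 ∥ Lp-1 ∷ Lp ∥ L0 ∷ S0 ∥ Lp-1 ∷ Mp-2 ∥ Lp ∷ []
chains 3F = M , Mp-1 ∥ L1 ∷ S0 ∥ L0 ∷ Mp-1 ∥ Lp ∷ S0 ∥ S0 ∷ Mp-1 ∥ Mp-1 ∷ []
chains 4F = S , S0 ∥ L1 ∷ Mp-1 ∥ L0 ∷ S0 ∥ Lp ∷ Mp-2 ∥ S0 ∷ Lp ∥ Mp-2 ∷ []
chains 5F = M , Mp-2 ∥ L0 ∷ Lp-2 ∥ Lp-1 ∷ Lp ∥ L0 ∷ S0 ∥ Lp ∷ Mp-1 ∥ S0 ∷ []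
chains 6F = M , Mp-2 ∥ L0 ∷ Lp-1 ∥ Lp ∷ Lp-1 ∥ S0 ∷ Lp-1 ∥ Mp-1 ∷ Lp ∥ S0 ∷ []

module _ where
  open +-*-Solver

  module Formal {n} (Q : Polynomial n) = Evaluation {Polynomial n} _:+_ _:*_ _:-_ (λ k → con (+ k)) Q
  module Value (Q : ℤ) = Evaluation ℤ._+_ ℤ._*_ ℤ._-_ +_ Q

  -- `unit a` is the S or M left of the insertion point, which opens the factor; `w` is the inserted
  -- word. The factor ends just before the L on the right.
  outcome : ∀ Q → ℤ × ℤ × ℤ → Fin 7 → ℤ × ℤ × ℤ
  outcome Q w c = let a , chain = chains c in run chain (unit a +ᵥ w)
    where open Value Q

  formal : ∀ {n} → Polynomial n → Polynomial n × Polynomial n × Polynomial n → Fin 7 → Polynomial n × Polynomial n × Polynomial n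
  formal Q w c = let a , chain = chains c in run chain (unit a +ᵥ w)
    where open Formal Q

  Totals : ∀ {n} → Fin 7 → Polynomial n → Polynomial n → Polynomial n → Polynomial n → Polynomial n × Polynomial n
  Totals c Q l s m = total (formal Q (l , s , m) c) := total (formal Q (l , s , m) 0F)
    where open Formal Q

  Weights : ∀ {n} → Fin 7 → Polynomial n → Polynomial n → Polynomial n → Polynomial n → Polynomial n × Polynomial n
  Weights c Q l s m = weigh (formal Q (l , s , m) c) := weigh (formal Q (l , s , m) 0F) :+ con (+ toℕ c)
    where open Formal Q

  -- All chains have length five, so the inserted vector meets the same fifth power of the incidence
  -- matrix in each of them and cancels. What remains is a polynomial identity in Q.
  totals : ∀ c Q l s m → Value.total Q (outcome Q (l , s , m) c) ≡ Value.total Q (outcome Q (l , s , m) 0F)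
  totals 0F = λ _ _ _ _ → refl
  totals 1F = solve 4 (Totals 1F) refl
  totals 2F = solve 4 (Totals 2F) refl
  totals 3F = solve 4 (Totals 3F) refl
  totals 4F = solve 4 (Totals 4F) refl
  totals 5F = solve 4 (Totals 5F) refl
  totals 6F = solve 4 (Totals 6F) refl

  weights : ∀ c Q l s m → Value.weigh Q (outcome Q (l , s , m) c) ≡ Value.weigh Q (outcome Q (l , s , m) 0F) ℤ.+ + toℕ c
  weights 0F = solve 4 (Weights 0F) refl
  weights 1F = solve 4 (Weights 1F) refl
  weights 2F = solve 4 (Weights 2F) refl
  weights 3F = solve 4 (Weights 3F) refl
  weights 4F = solve 4 (Weights 4F) refl
  weights 5F = solve 4 (Weights 5F) refl
  weights 6F = solve 4 (Weights 6F) refl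

-- Realising the seven factors in the fixed point

module Extremes (q : ℕ) where

  open FixedPoint q
  open Value (+ q)

  ↑ : Parikh → ℤ × ℤ × ℤ
  ↑ (l , s , m) = + l , + s , + m

  valueℕ : ∀ {a b} → Symbol a b → ℕ
  valueℕ L0   = 0
  valueℕ L1   = 1
  valueℕ Lp-2 = q
  valueℕ Lp-1 = 1 + q
  valueℕ Lp   = 2 + q
  valueℕ Mp-2 = q
  valueℕ Mp-1 = 1 + q
  valueℕ S0   = 0

  value≡ : ∀ {a b} (x : Symbol a b) → value x ≡ + valueℕ x
  value≡ L0   = refl
  value≡ L1   = refl
  value≡ Lp-2 = refl
  value≡ Lp-1 = refl
  value≡ Lp   = refl
  value≡ Mp-2 = refl
  value≡ Mp-1 = refl
  value≡ S0   = refl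

  digit : ∀ {a b} (x : Symbol a b) → Digit a (valueℕ x) b
  digit L0   = LL z≤n
  digit L1   = LL (s≤s z≤n)
  digit Lp-2 = LL (n≤1+n q)
  digit Lp-1 = LL ≤-refl
  digit Lp   = LS
  digit Mp-2 = ML ≤-refl
  digit Mp-1 = MS
  digit S0   = SM

  -- w = Ψ(u[i,j)) is taken over ℤ because transfer subtracts digits.
  record Gap (d : ℕ) (a b : Letter) (w : ℤ × ℤ × ℤ) : Set where
    constructor gap
    field
      i j  : ℕ
      vᵢ   : v i ≡ a
      vⱼ   : v j ≡ b
      i<j  : d + i < j
      ψ≡   : ↑ (ψ j) ≡ ↑ (ψ i) +ᵥ w

  -- The letters strictly between the two ends have nonempty images, so a lower bound on their
  -- number survives substitution. It guarantees that the final factors are long, which the integer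
  -- vector `w` alone does not show.
  pos-gap : ∀ {d i j r r′} → r < size (v i) → d + i < j → d + (pos i + r) < pos j + r′
  pos-gap {d} {i} {j} {r} {r′} r< i<j with m≤n⇒∃[o]m+o≡n i<j
  ... | e , refl = begin
    suc (d + (pos i + r))                          ≡⟨ +-suc d (pos i + r) ⟨
    d + suc (pos i + r)                            ≡⟨ cong (_+_ d) (+-suc (pos i) r) ⟨
    d + (pos i + suc r)                            ≤⟨ +-monoʳ-≤ d (+-monoʳ-≤ (pos i) r<) ⟩
    d + pos (suc i)                                  ≡⟨ +-comm d (pos (suc i)) ⟩
    pos (suc i) + d                                  ≤⟨ +-monoʳ-≤ (pos (suc i)) (≤-trans (m≤m+n d e) (n≤span (suc i) (d + e))) ⟩
    pos (suc i) + span (suc i) (d + e)             ≡⟨ pos-span (suc i) (d + e) ⟨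
    pos (suc i + (d + e))                          ≡⟨ cong pos (lem i d e) ⟩
    pos (suc (d + i) + e)                          ≤⟨ m≤m+n _ r′ ⟩
    pos (suc (d + i) + e) + r′                   ∎
    where
    open ≤-Reasoning
    lem : ∀ i d e → suc i + (d + e) ≡ suc (d + i) + e
    lem = ℕ-Solver.solve-∀

  ↑-image : ∀ w r → ↑ (image w r) ≡ transfer (↑ w) 0ℤ (+ r)
  ↑-image (l , s , m) r = cong (_, (+ (l + m) , + s)) (begin
    + (p * l + suc q * m + r)                      ≡⟨ cong₂ (λ x y → x ℤ.+ y ℤ.+ + r) (ℤₚ.pos-* p l) (ℤₚ.pos-* (suc q) m) ⟩
    + p ℤ.* + l ℤ.+ + suc q ℤ.* + m ℤ.+ + r                ≡⟨ ℤₚ.+-identityʳ _ ⟨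
    + p ℤ.* + l ℤ.+ + suc q ℤ.* + m ℤ.+ + r ℤ.- 0ℤ         ∎)
    where open ≡-Reasoning

  transfer-+ᵥ : ∀ x w r r′ → transfer (x +ᵥ w) 0ℤ r′ ≡ transfer x 0ℤ r +ᵥ transfer w r r′
  transfer-+ᵥ (l , s , m) (l′ , s′ , m′) r r′ = cong₂ _,_ (lem₁ (+ 2 ℤ.+ + q) (+ 1 ℤ.+ + q) l m l′ m′ r r′) (cong (_, s ℤ.+ s′) (lem₂ l m l′ m′))
    where
    lem₁ : ∀ P P′ l m l′ m′ r r′ → P ℤ.* (l ℤ.+ l′) ℤ.+ P′ ℤ.* (m ℤ.+ m′) ℤ.+ r′ ℤ.- + 0 ≡
           (P ℤ.* l ℤ.+ P′ ℤ.* m ℤ.+ r ℤ.- + 0) ℤ.+ (P ℤ.* l′ ℤ.+ P′ ℤ.* m′ ℤ.+ r′ ℤ.- r)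
    lem₁ = ℤ-Solver.solve-∀
    lem₂ : ∀ l m l′ m′ → l ℤ.+ l′ ℤ.+ (m ℤ.+ m′) ≡ l ℤ.+ m ℤ.+ (l′ ℤ.+ m′)
    lem₂ = ℤ-Solver.solve-∀

  inflate : ∀ {d a b a′ b′ w} (x : Symbol a a′) (y : Symbol b b′) → Gap d a b w → Gap d a′ b′ (transfer w (value x) (value y))
  inflate {w = w} x y (gap i j refl refl i<j ψ≡) =
    gap (pos i + valueℕ x) (pos j + valueℕ y) (v-digit i (digit x)) (v-digit j (digit y)) (pos-gap {i = i} (digit<size (digit x)) i<j) (begin
      ↑ (ψ (pos j + valueℕ y))                                         ≡⟨ cong ↑ (ψ-digit j (digit y)) ⟩
      ↑ (image (ψ j) (valueℕ y))                                         ≡⟨ ↑-image (ψ j) (valueℕ y) ⟩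
      transfer (↑ (ψ j)) 0ℤ (+ valueℕ y)                                 ≡⟨ cong (λ z → transfer z 0ℤ (+ valueℕ y)) ψ≡ ⟩
      transfer (↑ (ψ i) +ᵥ w) 0ℤ (+ valueℕ y)                            ≡⟨ transfer-+ᵥ (↑ (ψ i)) w (+ valueℕ x) (+ valueℕ y) ⟩
      transfer (↑ (ψ i)) 0ℤ (+ valueℕ x) +ᵥ transfer w (+ valueℕ x) (+ valueℕ y) ≡⟨ cong₂ _+ᵥ_
        (sym (trans (cong ↑ (ψ-digit i (digit x))) (↑-image (ψ i) (valueℕ x))))
        (cong₂ (transfer w) (sym (value≡ x)) (sym (value≡ y))) ⟩
      ↑ (ψ (pos i + valueℕ x)) +ᵥ transfer w (value x) (value y)       ∎)
    where open ≡-Reasoning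

  inflate* : ∀ {d a b w} (c : Chain a b) → Gap d a b w → ∃₂ λ a′ b′ → Gap d a′ b′ (run c w)
  inflate* []          g = _ , _ , g
  inflate* (x ∥ y ∷ c) g = inflate* c (inflate x y g)

  total-+ᵥ : ∀ x y → total (x +ᵥ y) ≡ total x ℤ.+ total y
  total-+ᵥ (l , s , m) (l′ , s′ , m′) = lem l s m l′ s′ m′
    where
    lem : ∀ l s m l′ s′ m′ → l ℤ.+ l′ ℤ.+ (s ℤ.+ s′) ℤ.+ (m ℤ.+ m′) ≡ l ℤ.+ s ℤ.+ m ℤ.+ (l′ ℤ.+ s′ ℤ.+ m′)
    lem = ℤ-Solver.solve-∀

  weigh-+ᵥ : ∀ x y → weigh (x +ᵥ y) ≡ weigh x ℤ.+ weigh y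
  weigh-+ᵥ (l , s , m) (l′ , s′ , m′) = lem s m s′ m′
    where
    lem : ∀ s m s′ m′ → + 3 ℤ.* (s ℤ.+ s′) ℤ.+ (m ℤ.+ m′) ≡ + 3 ℤ.* s ℤ.+ m ℤ.+ (+ 3 ℤ.* s′ ℤ.+ m′)
    lem = ℤ-Solver.solve-∀

  gap-length : ∀ {d a b w} (g : Gap d a b w) → + Gap.j g ≡ + Gap.i g ℤ.+ total w
  gap-length {w = w} (gap i j _ _ _ ψ≡) = begin
    + j                       ≡⟨ cong +_ (∣ψ∣ j) ⟨
    total (↑ (ψ j))           ≡⟨ cong total ψ≡ ⟩
    total (↑ (ψ i) +ᵥ w)      ≡⟨ total-+ᵥ (↑ (ψ i)) w ⟩
    + ∣ ψ i ∣ₚ ℤ.+ total w    ≡⟨ cong (λ x → + x ℤ.+ total w) (∣ψ∣ i) ⟩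
    + i ℤ.+ total w           ∎
    where open ≡-Reasoning

  -- `inflate` merely preserves the bound on the length; once the vector is known exactly, the bound
  -- can be raised to the true value.
  widen : ∀ {d d′ a b w} → total w ≡ + suc d′ → Gap d a b w → Gap d′ a b w
  widen {d′ = d′} {w = w} total≡ g@(gap i j vᵢ vⱼ _ ψ≡) = gap i j vᵢ vⱼ (≤-reflexive (sym j≡)) ψ≡
    where
    j≡ : j ≡ suc (d′ + i)
    j≡ = ℤₚ.+-injective (trans (gap-length g) (trans (cong (ℤ._+_ (+ i)) total≡) (cong +_ (+-comm i (suc d′)))))

  gap-weight : ∀ {d a b w} n (g : Gap d a b w) → total w ≡ + n → + weight (factorΨ v (Gap.i g) n) ≡ weigh w
  gap-weight {w = w} n g@(gap i j _ _ _ ψ≡) total≡ = ℤ-cancelˡ (weigh (↑ (ψ i))) _ _ (begin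
    weigh (↑ (ψ i)) ℤ.+ + weight f           ≡⟨ cong (ℤ._+_ (weigh (↑ (ψ i)))) (weight≡ f) ⟩
    weigh (↑ (ψ i)) ℤ.+ weigh (↑ f)          ≡⟨ weigh-+ᵥ (↑ (ψ i)) (↑ f) ⟨
    weigh (↑ (ψ i ⊕ f))                      ≡⟨ cong (λ x → weigh (↑ x)) (ψ-factor i n) ⟨
    weigh (↑ (ψ (i + n)))                  ≡⟨ cong (λ x → weigh (↑ (ψ x))) j≡ ⟨
    weigh (↑ (ψ j))                          ≡⟨ cong weigh ψ≡ ⟩
    weigh (↑ (ψ i) +ᵥ w)                     ≡⟨ weigh-+ᵥ (↑ (ψ i)) w ⟩
    weigh (↑ (ψ i)) ℤ.+ weigh w              ∎)
    where
    open ≡-Reasoning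
    f = factorΨ v i n
    weight≡ : ∀ x → + weight x ≡ weigh (↑ x)
    weight≡ (l , s , m) = cong (ℤ._+ + m) (ℤₚ.pos-* 3 s)
    j≡ : j ≡ i + n
    j≡ = ℤₚ.+-injective (trans (gap-length g) (cong (ℤ._+_ (+ i)) total≡))

  -- A word with Parikh vector x can be inserted into both S.L and M.L.
  Insertable : Parikh → Set
  Insertable x = Gap ∣ x ∣ₚ S L (unit S +ᵥ ↑ x) × Gap ∣ x ∣ₚ M L (unit M +ᵥ ↑ x)

  cast : ∀ {d a b w w′} → w ≡ w′ → Gap d a b w → Gap d a b w′
  cast {d} {a} {b} = subst (Gap d a b)

  total-unit : ∀ a x → total (unit a +ᵥ ↑ x) ≡ + suc ∣ x ∣ₚ
  total-unit L x = total-+ᵥ (unit L) (↑ x)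
  total-unit S x = total-+ᵥ (unit S) (↑ x)
  total-unit M x = total-+ᵥ (unit M) (↑ x)

  -- The single letter L can be inserted into S.L and M.L: `gˢ` and `gᴹ` are the factors SL and ML
  -- followed by L, grown from the SL at position p. One more substitution turns the inserted L into
  -- L^p S.
  insertable-base : Insertable (p , 1 , 0)
  insertable-base =
    widen (total-unit S (p , 1 , 0)) (cast (cong (_, (+ 2 , + 0)) (lem₂ P P′)) (inflate Mp-1 L0 gᴹ)) ,
    widen (total-unit M (p , 1 , 0)) (cast (cong (_, (+ 1 , + 1)) (lem₃ P P′)) (inflate S0 L0 gˢ))
    where
    P = + 2 ℤ.+ + q
    P′ = + 1 ℤ.+ + q
    lem₁ : ∀ P P′ r → P ℤ.* + 0 ℤ.+ P′ ℤ.* + 0 ℤ.+ r ℤ.- + 0 ≡ r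
    lem₁ = ℤ-Solver.solve-∀
    lem₂ : ∀ P P′ → P ℤ.* + 1 ℤ.+ P′ ℤ.* + 1 ℤ.+ + 0 ℤ.- P′ ≡ + 0 ℤ.+ P
    lem₂ = ℤ-Solver.solve-∀
    lem₃ : ∀ P P′ → P ℤ.* + 1 ℤ.+ P′ ℤ.* + 0 ℤ.+ + 0 ℤ.- + 0 ≡ + 0 ℤ.+ P
    lem₃ = ℤ-Solver.solve-∀
    lem₄ : ∀ P P′ → P ℤ.* + 0 ℤ.+ P′ ℤ.* + 1 ℤ.+ + 1 ℤ.- P′ ≡ + 1
    lem₄ = ℤ-Solver.solve-∀
    start : Gap 0 S L (+ 0 , + 1 , + 0)
    start = gap p (suc p) v-p v-1+p ≤-refl (cong ↑ (cong (λ a → ψ p ⊕ letterΨ a) v-p))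
    gᴹ : Gap 0 M L (+ 1 , + 0 , + 1)
    gᴹ = cast (cong (_, (+ 0 , + 1)) (lem₁ P P′ (+ 1))) (inflate S0 L1 start)
    gˢ : Gap 0 S L (+ 1 , + 1 , + 0)
    gˢ = cast (cong (_, (+ 1 , + 0)) (lem₄ P P′)) (inflate Mp-1 L1 (cast (cong (_, (+ 0 , + 1)) (lem₁ P P′ (+ 0))) (inflate S0 L0 start)))

  -- φ_p(S) = M, φ_p(M) ends in S, and φ_p(L) begins with L. Substitution therefore preserves the
  -- right side of the insertion point and exchanges the two left sides.
  insertable-image : ∀ x → Insertable x → Insertable (image x 0)
  insertable-image x@(l , s , m) (gˢ , gᴹ) =
    widen (total-unit S (image x 0)) (cast eqˢ (inflate Mp-1 L0 gᴹ)) ,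
    widen (total-unit M (image x 0)) (cast eqᴹ (inflate S0 L0 gˢ))
    where
    P = + 2 ℤ.+ + q
    P′ = + 1 ℤ.+ + q
    l≡ : + (p * l + suc q * m + 0) ≡ P ℤ.* + l ℤ.+ P′ ℤ.* + m ℤ.+ + 0
    l≡ = cong₂ (λ x y → x ℤ.+ y ℤ.+ + 0) (ℤₚ.pos-* p l) (ℤₚ.pos-* (suc q) m)
    lemˢ : ∀ P P′ l m → P ℤ.* (+ 0 ℤ.+ l) ℤ.+ P′ ℤ.* (+ 1 ℤ.+ m) ℤ.+ + 0 ℤ.- P′ ≡ + 0 ℤ.+ (P ℤ.* l ℤ.+ P′ ℤ.* m ℤ.+ + 0)
    lemˢ = ℤ-Solver.solve-∀
    lemᴹ : ∀ P P′ l m → P ℤ.* (+ 0 ℤ.+ l) ℤ.+ P′ ℤ.* (+ 0 ℤ.+ m) ℤ.+ + 0 ℤ.- + 0 ≡ + 0 ℤ.+ (P ℤ.* l ℤ.+ P′ ℤ.* m ℤ.+ + 0)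
    lemᴹ = ℤ-Solver.solve-∀
    eqˢ : transfer (unit M +ᵥ ↑ x) P′ (+ 0) ≡ unit S +ᵥ ↑ (image x 0)
    eqˢ = cong₂ _,_ (trans (lemˢ P P′ (+ l) (+ m)) (cong (ℤ._+_ (+ 0)) (sym l≡))) (cong (λ y → + y , + s) (+-suc l m))
    eqᴹ : transfer (unit S +ᵥ ↑ x) (+ 0) (+ 0) ≡ unit M +ᵥ ↑ (image x 0)
    eqᴹ = cong (_, (+ (l + m) , + suc s)) (trans (lemᴹ P P′ (+ l) (+ m)) (cong (ℤ._+_ (+ 0)) (sym l≡)))

  -- The condition `1 ≤ proj₁ x` keeps the induction going: a word containing L has a strictly
  -- longer image, again containing L.
  insertable : ∀ N → ∃ λ x → Insertable x × 1 ≤ proj₁ x × N ≤ ∣ x ∣ₚ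
  insertable zero    = (p , 1 , 0) , insertable-base , s≤s z≤n , z≤n
  insertable (suc N) with insertable N
  ... | x@(suc l , s , m) , ins , _ , N≤ = image x 0 , insertable-image x ins , s≤s z≤n , ≤-trans (s≤s N≤) (begin
    suc (suc l + s + m)                                                      ≤⟨ m≤m+n _ (l + q * (suc l + m) + (suc l + m)) ⟩
    suc (suc l + s + m) + (l + q * (suc l + m) + (suc l + m))    ≡⟨ lem q l s m ⟩
    ∣ image x 0 ∣ₚ                                                               ∎)
    where
    open ≤-Reasoning
    lem : ∀ q l s m → suc (suc l + s + m) + (l + q * (suc l + m) + (suc l + m)) ≡
          (2 + q) * suc l + suc q * m + 0 + (suc l + m) + s
    lem = ℕ-Solver.solve-∀

  sevenWeights : ∀ N → SevenWeights v N
  sevenWeights N with insertable N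
  ... | x@(l , s , m) , (gˢ , gᴹ) , _ , N≤ = n , weight (factorΨ v (Gap.i g₀) n) , N≤n , found
    where
    w : Fin 7 → ℤ × ℤ × ℤ
    w = outcome (+ q) (↑ x)
    start : ∀ c → Gap ∣ x ∣ₚ (proj₁ (chains c)) L (unit (proj₁ (chains c)) +ᵥ ↑ x)
    start 0F = gˢ
    start 1F = gˢ
    start 2F = gᴹ
    start 3F = gᴹ
    start 4F = gˢ
    start 5F = gᴹ
    start 6F = gᴹ
    gaps : ∀ c → ∃₂ λ a b → Gap ∣ x ∣ₚ a b (w c)
    gaps c = inflate* (proj₂ (chains c)) (start c)
    g₀ = proj₂ (proj₂ (gaps 0F))
    -- The length is read off the first factor; `totals` transfers it to the other six.
    n = Gap.j g₀ ∸ Gap.i g₀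
    N≤n : N ≤ n
    N≤n = ≤-trans N≤ (m+n≤o⇒m≤o∸n ∣ x ∣ₚ (<⇒≤ (Gap.i<j g₀)))
    total₀ : total (w 0F) ≡ + n
    total₀ = sym (ℤ-cancelˡ (+ Gap.i g₀) _ _ (trans
      (cong +_ (m+[n∸m]≡n (≤-trans (m≤n+m _ ∣ x ∣ₚ) (<⇒≤ (Gap.i<j g₀)))))
      (gap-length g₀)))
    found : ∀ c → ∃ λ i → weight (factorΨ v i n) ≡ weight (factorΨ v (Gap.i g₀) n) + toℕ c
    found c = Gap.i g , ℤₚ.+-injective (begin
      + weight (factorΨ v (Gap.i g) n)                      ≡⟨ gap-weight n g (trans (totals c (+ q) (+ l) (+ s) (+ m)) total₀) ⟩
      weigh (w c)                                           ≡⟨ weights c (+ q) (+ l) (+ s) (+ m) ⟩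
      weigh (w 0F) ℤ.+ + toℕ c                              ≡⟨ cong (ℤ._+ + toℕ c) (gap-weight n g₀ total₀) ⟨
      + weight (factorΨ v (Gap.i g₀) n) ℤ.+ + toℕ c         ∎)
      where
      open ≡-Reasoning
      g = proj₂ (proj₂ (gaps c))

-- Certificates and conclusion

certificate₂ : Automaton.Certificate 0 0
certificate₂ = record { trie = Automaton.reached 0 0 ; valid≡ = refl }

certificate₃₊ : Automaton.Certificate 1 1
certificate₃₊ = record { trie = Automaton.reached 1 1 ; valid≡ = refl }

-- For p = 2 all forms are constant (slope 0); the second certificate has P = 3 + t and so serves
-- every larger p at once. The `refl` in each certificate makes the type checker carry out the
-- search and the check.
u-separated : ∀ q → Separated (u (2 + q))
u-separated zero    = Sound.Invariant.separates 0 0 0 0 refl certificate₂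
u-separated (suc t) = Sound.Invariant.separates (suc t) 1 1 t (cong suc (sym (+-identityʳ t))) certificate₃₊

theorem5 : (p : ℕ) → 1 < p →
    ((n : ℕ) → ∃ λ k → k ≤ 7 × HasAC (u p) n k)
    × ((N : ℕ) → ∃ λ n → N ≤ n × HasAC (u p) n 7)
theorem5 (suc (suc q)) (s≤s (s≤s _)) =
  bounded-by-7 recurrent (u-separated q) , λ N → attains-7 recurrent (u-separated q) (Extremes.sevenWeights q N)
  where open FixedPoint q using (recurrent)
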